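{- Let $G$ be a $C_6$-free triangle-free planar graph on $n$ vertices with minimum degree $\delta(G)\ge 3$, and let $e_G$ be its number of edges. Then $$e_G\le \left\lfloor \frac{9}{5}n-4\right\rfloor.$$ Moreover, equality holds for infinitely many integers $n$: for infinitely many $n$ there exists a $C_6$-free triangle-free planar graph on $n$ vertices with minimum degree at least $3$ and exactly $\left\lfloor \frac{9}{5}n-4\right\rfloor$ edges.
   Context: All graphs are finite, undirected and simple. $C_\ell$ denotes the cycle of length $\ell$; $G$ is $H$-free if it does not contain $H$ as a (not necessarily induced) subgraph. -}

module Defs where

open import Data.Bool.Base using (Bool; true; false; T; _∨_)
open import Data.Bool.Properties using (∨-comm)
open import Data.Fin.Base using (Fin; toℕ)
open import Data.Fin.Properties using (toℕ<n; _<?_)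
open import Data.List.Base using (List; length; map; filter; allFin; cartesianProduct)
open import Data.List.Extrema.Nat using (min)
open import Data.Nat.Base as ℕ using (ℕ; suc; s≤s; NonZero; _+_; _*_; _%_; _≡ᵇ_)
open import Data.Nat.DivMod using (m<n⇒m%n≡m; n%n≡0)
import Data.Nat.Properties as ℕ
open import Data.Unit.Base using (tt)
open import Data.Product.Base using (Σ-syntax; ∃-syntax; _×_; _,_)
open import Data.Sum.Base using (inj₁; inj₂)
open import Function.Base using (_∘_)
open import Function.Bundles using (Inverse; _↔_; _⇔_)
open import Function.Definitions using (Injective)
open import Level using (0ℓ)
open import Relation.Binary.Bundles using (Setoid)
open import Relation.Binary.Construct.Closure.Equivalence as Eq using (EqClosure)
open import Relation.Binary.Core using (Rel)
open import Relation.Binary.PropositionalEquality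
  using (_≡_; _≢_; refl; sym; trans; cong; cong₂; subst; setoid)
open import Relation.Nullary.Decidable using (True; toWitness; _×-dec_; T?)
open import Relation.Nullary.Negation using (¬_; contradiction)

record Graph (n : ℕ) : Set where
  field
    adj        : Fin n → Fin n → Bool
    adj-sym    : ∀ u v → adj u v ≡ adj v u
    adj-irrefl : ∀ v → adj v v ≡ false

  Adj : Rel (Fin n) 0ℓ
  Adj u v = T (adj u v)

  degree : Fin n → ℕ
  degree v = length (filter (T? ∘ adj v) (allFin n))

  -- Every degree is less than n, so the default value n of the minimum is only
  -- reached when n = 0; the graph without vertices gets δ = 0.
  δ : ℕ
  δ = min n (map degree (allFin n))

  edges : List (Fin n × Fin n)
  edges = filter (λ (u , v) → (u <? v) ×-dec T? (adj u v))
                 (cartesianProduct (allFin n) (allFin n))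

  edgeCount : ℕ
  edgeCount = length edges

  isolatedCount : ℕ
  isolatedCount = length (filter (λ v → degree v ℕ.≟ 0) (allFin n))

open Graph using (Adj)

record Dart {n} (G : Graph n) : Set where
  constructor dart
  field
    tail head : Fin n
    joined    : Adj G tail head

open Dart public using (tail; head)

rev : ∀ {n} {G : Graph n} → Dart G → Dart G
rev {G = G} (dart u v p) = dart v u (subst T (Graph.adj-sym G u v) p)

-- H is a subgraph of G, not necessarily induced.
_⊑_ : ∀ {m n} → Graph m → Graph n → Set
_⊑_ {m} {n} H G =
  Σ[ f ∈ (Fin m → Fin n) ]
    Injective _≡_ _≡_ f × (∀ {i j} → Adj H i j → Adj G (f i) (f j))

infix 4 _⊑_

_isFree : ∀ {m n} → Graph m → Graph n → Set
(H isFree) G = ¬ (H ⊑ G)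

module _ (ℓ : ℕ) .{{_ : NonZero ℓ}} where

  cycleAdj : Fin ℓ → Fin ℓ → Bool
  cycleAdj i j = (suc (toℕ i) % ℓ ≡ᵇ toℕ j) ∨ (suc (toℕ j) % ℓ ≡ᵇ toℕ i)

suc-%-≢ : ∀ {ℓ} .{{_ : NonZero ℓ}} → 2 ℕ.≤ ℓ → ∀ {i} → i ℕ.< ℓ → suc i % ℓ ≢ i
suc-%-≢ {ℓ} 2≤ℓ {i} i<ℓ eq with ℕ.m≤n⇒m<n∨m≡n i<ℓ
... | inj₁ 1+i<ℓ = ℕ.1+n≢n (trans (sym (m<n⇒m%n≡m 1+i<ℓ)) eq)
... | inj₂ refl  = contradiction (subst (2 ℕ.≤_) (cong suc (trans (sym eq) (n%n≡0 ℓ))) 2≤ℓ)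
                     λ { (s≤s ()) }

≢⇒≡ᵇ-false : ∀ {m n} → m ≢ n → (m ≡ᵇ n) ≡ false
≢⇒≡ᵇ-false {m} {n} m≢n with m ≡ᵇ n in eq
... | false = refl
... | true  = contradiction (ℕ.≡ᵇ⇒≡ m n (subst T (sym eq) tt)) m≢n

C : (ℓ : ℕ) {3≤ℓ : True (3 ℕ.≤? ℓ)} → Graph ℓ
C ℓ@(suc _) {3≤ℓ} = record
  { adj        = cycleAdj ℓ
  ; adj-sym    = λ i j → ∨-comm (suc (toℕ i) % ℓ ≡ᵇ toℕ j) (suc (toℕ j) % ℓ ≡ᵇ toℕ i)
  ; adj-irrefl = λ i → let eq = ≢⇒≡ᵇ-false (suc-%-≢ (ℕ.<⇒≤ (toWitness 3≤ℓ)) (toℕ<n i))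
                       in cong₂ _∨_ eq eq
  }

HasSize : Setoid 0ℓ 0ℓ → ℕ → Set
HasSize S k = Inverse S (setoid (Fin k))

Components : ∀ {n} → Graph n → Setoid 0ℓ 0ℓ
Components G = Eq.setoid (Adj G)

SameOrbit : {A : Set} → (A → A) → Rel A 0ℓ
SameOrbit f = EqClosure (λ x y → f x ≡ y)

Orbits : {A : Set} → (A → A) → Setoid 0ℓ 0ℓ
Orbits f = Eq.setoid (λ x y → f x ≡ y)

-- A combinatorial embedding of G in an orientable surface: a permutation of the
-- darts whose cycles are exactly the sets of darts leaving a common vertex, i.e.
-- a cyclic order of the edges around each vertex.
record RotationSystem {n} (G : Graph n) : Set where
  field
    rotation : Dart G ↔ Dart G

  open Inverse rotation public using () renaming (to to rotate)

  field
    orbit⇔tail : ∀ d d′ → SameOrbit rotate d d′ ⇔ tail d ≡ tail d′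

  -- Successor of a dart on the boundary walk of the face beside it.
  nextOnFace : Dart G → Dart G
  nextOnFace = rotate ∘ rev

  Faces : Setoid 0ℓ 0ℓ
  Faces = Orbits nextOnFace

-- Each component is embedded in its own surface, of Euler characteristic at
-- most 2 and equal to 2 only for the sphere.  Hence all of them are spheres
-- exactly when the characteristics |V| - |E| + |F| add up to twice the number
-- of components.  Faces are counted component by component (no face is shared
-- between components), and an isolated vertex has no darts but one face.
Spherical : ∀ {n} {G : Graph n} → RotationSystem G → Set
Spherical {n} {G} R =
  ∃[ f ] ∃[ c ] HasSize Faces f × HasSize (Components G) c
              × n + (f + isolatedCount) ≡ edgeCount + 2 * c
  where
  open Graph G using (edgeCount; isolatedCount)
  open RotationSystem R using (Faces)

-- A graph is planar iff it embeds in the sphere; embeddings are taken up to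
-- homeomorphism and encoded by their rotation systems.
Planar : ∀ {n} → Graph n → Set
Planar G = Σ[ R ∈ RotationSystem G ] Spherical R

{-# OPTIONS --safe #-}
module Submission where

-- By Euler's formula the bound says n + 10 f ≤ 5 e.  Every face has length at least
-- four, and no edge lies on two faces of length four, as these would form a hexagon.
-- Give every dart five tokens and every face twenty, paid by its darts: a square uses
-- all tokens of its darts, a longer face only four of each.  Around a vertex a dart on
-- a square is followed by one that is not, so, the degree being at least three, two
-- darts at each vertex keep a token: 20 f + 2 n ≤ 10 e.
--
-- Exact equality forces faces of length four and five and a tight count at every vertex.
-- Such maps arise from the unit square grid on a long 1 × 1 box: each grid square becomes
-- a 4-cycle with one vertex per side, and along a grid edge the two vertices are either
-- identified or joined, so that every grid vertex becomes a pentagon.  All adjacencies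
-- are local along the tube, which therefore folds, locally injectively, onto a fixed
-- graph with 72 vertices, where the absence of closed non-backtracking walks of length
-- three and six is checked by computation.

open import Defs
open import Data.Bool.Base using (Bool; true; false; T; _∨_)
open import Data.Bool.ListAction using (all)
open import Data.Bool.Properties using (T-irrelevant)
open import Data.Fin.Base using (Fin; zero; suc; toℕ; fromℕ; inject₁; opposite; remQuot; _<_)
open import Data.Fin.Induction using (<-weakInduction)
open import Data.Fin.Patterns
open import Data.Fin.Properties
  using (_≟_; _<?_; <-cmp; <-asym; any?; all?; +↔⊎; *↔×; 2↔Bool; injective⇒≤; toℕ-injective;
         toℕ<n; inject₁-injective; fromℕ≢inject₁; opposite-involutive)
open import Data.Fin.Relation.Unary.Top using (view; view-fromℕ; view-inject₁; ‵fromℕ; ‵inject₁)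
open import Data.Integer.Base as ℤ using (+_; _≤_)
import Data.Integer.Properties as ℤ
open import Data.List.Base using (List; []; _∷_; length; lookup; map; filter; allFin; cartesianProduct)
open import Data.List.Extrema.Nat using (min≤xs; v≤min⁺)
open import Data.List.Membership.Propositional using (_∈_)
open import Data.List.Membership.Propositional.Properties
  using (∈-filter⁺; ∈-filter⁻; ∈-map⁺; ∈-allFin; ∈-cartesianProduct⁺; ∈-lookup)
open import Data.List.Properties using (filter-none)
open import Data.List.Relation.Unary.All as All using ([]; _∷_)
import Data.List.Relation.Unary.All.Properties as All
open import Data.List.Relation.Unary.AllPairs as AllPairs using ([]; _∷_)
open import Data.List.Relation.Unary.Any as Any using ()
open import Data.List.Relation.Unary.Any.Properties using (lookup-index)
import Data.List.Relation.Unary.Unique.DecPropositional as DecUnique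
open import Data.List.Relation.Unary.Unique.Propositional using (Unique)
open import Data.List.Relation.Unary.Unique.Propositional.Properties
  using (allFin⁺; cartesianProduct⁺; filter⁺)
open import Data.Nat.Base as ℕ using (ℕ; zero; suc; s≤s; z≤n)
import Data.Nat.DivMod as ℕ
import Data.Nat.Properties as ℕ
open import Data.Nat.Solver using (module +-*-Solver)
open import Data.Product.Base using (_×_; _,_; ∃-syntax; Σ-syntax; proj₁; proj₂; swap; uncurry)
open import Data.Product.Function.NonDependent.Propositional using (_×-↔_; _×-↣_)
open import Data.Product.Properties using (,-injective; ×-≡,≡→≡; ≡-dec)
open import Data.Rational.Unnormalised.Base using (floor; _/_; _*_; _-_)
open import Data.Sum.Base using (_⊎_; inj₁; inj₂; [_,_]′)
open import Data.Sum.Function.Propositional using (_⊎-↔_)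
open import Data.Unit.Base using (tt)
open import Function.Base using (_∘_; id; const; case_of_)
open import Function.Bundles
  using (_↔_; _↣_; _⇔_; Inverse; Injection; Equivalence; mk↣; mk⇔; mk↔ₛ′)
open import Function.Construct.Composition as Compose using (_↣-∘_)
open import Function.Construct.Identity using (↣-id)
open import Function.Definitions using (Injective)
open import Function.Properties.Equivalence using (⇔-isEquivalence)
open import Function.Properties.Inverse using (↔-refl; ↔-sym; ↔-trans; ↔⇒↣)
open import Relation.Binary.Construct.Closure.Equivalence as Eq using (EqClosure)
open import Relation.Binary.Definitions using (DecidableEquality; tri<; tri≈; tri>)
open import Relation.Binary.PropositionalEquality
  using (_≡_; _≢_; refl; sym; trans; cong; subst; subst₂; ≢-sym; isEquivalence; setoid;
         module ≡-Reasoning)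
open import Relation.Nullary.Decidable
  using (Dec; yes; no; does; T?; _×-dec_; ¬?; map′; does-⇔; dec-false; toWitness; fromWitness; isYes≗does)
open import Relation.Nullary.Negation using (¬_; contradiction)
open import Relation.Unary using (Decidable)

open Graph using (Adj; adj; adj-sym; adj-irrefl; degree; edges; δ; edgeCount; isolatedCount)

-- Comparing finite sizes by injections

lookup-injective : ∀ {A : Set} {xs : List A} → Unique xs → Injective _≡_ _≡_ (lookup xs)
lookup-injective (_    ∷ _)   {zero}  {zero}  _  = refl
lookup-injective (x∉xs ∷ _)   {zero}  {suc j} eq = contradiction eq (All.lookup x∉xs (∈-lookup j))
lookup-injective (x∉xs ∷ _)   {suc i} {zero}  eq = contradiction (sym eq) (All.lookup x∉xs (∈-lookup i))
lookup-injective (_    ∷ xs!) {suc i} {suc j} eq = cong suc (lookup-injective xs! eq)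

↣⇒≤ : ∀ {A B : Set} {a b} → Fin a ↔ A → A ↣ B → Fin b ↔ B → a ℕ.≤ b
↣⇒≤ α f β = injective⇒≤ (Injection.injective (↔⇒↣ (↔-sym β) ↣-∘ (f ↣-∘ ↔⇒↣ α)))

-- Darts, edges and short cycles in a graph

module GraphFacts {n} (G : Graph n) where

  Adj-sym : ∀ {u v} → Adj G u v → Adj G v u
  Adj-sym {u} {v} = subst T (adj-sym G u v)

  Adj⇒≢ : ∀ {u v} → Adj G u v → u ≢ v
  Adj⇒≢ {u} p refl = subst T (adj-irrefl G u) p

  dart-≡ : {d d′ : Dart G} → tail d ≡ tail d′ → head d ≡ head d′ → d ≡ d′
  dart-≡ {dart u v p} {dart _ _ q} refl refl = cong (dart u v) (T-irrelevant p q)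

  rev-involutive : (d : Dart G) → rev (rev d) ≡ d
  rev-involutive d = dart-≡ refl refl

  ∈-edges : ∀ {u v} → u < v → Adj G u v → (u , v) ∈ edges G
  ∈-edges {u} {v} u<v p =
    ∈-filter⁺ _ (∈-cartesianProduct⁺ (∈-allFin u) (∈-allFin v)) (u<v , p)

  edges-unique : Unique (edges G)
  edges-unique = filter⁺ _ (cartesianProduct⁺ (allFin⁺ n) (allFin⁺ n))

  edge : Fin (edgeCount G) → Fin n × Fin n
  edge = lookup (edges G)

  edge-property : ∀ k → proj₁ (edge k) < proj₂ (edge k) × Adj G (proj₁ (edge k)) (proj₂ (edge k))
  edge-property k = proj₂ (∈-filter⁻ (λ (u , v) → (u <? v) ×-dec T? (adj G u v)) {v = edge k}
                             {xs = cartesianProduct (allFin n) (allFin n)} (∈-lookup k))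

  ends : Dart G → Fin n × Fin n
  ends d = tail d , head d

  -- `edges` lists every edge once, from its smaller end; the Boolean tells whether a dart runs
  -- along or against that direction.
  orient : Bool → Fin n × Fin n → Fin n × Fin n
  orient true  = id
  orient false = swap

  dart→edge : (d : Dart G) → ∃[ o ] ∃[ k ] orient o (edge k) ≡ ends d
  dart→edge (dart u v p) with <-cmp u v
  ... | tri< u<v _ _ = true  , Any.index (∈-edges u<v p) , sym (lookup-index (∈-edges u<v p))
  ... | tri≈ _ u≡v _ = contradiction u≡v (Adj⇒≢ p)
  ... | tri> _ _ v<u = false , Any.index (∈-edges v<u (Adj-sym p)) ,
                       cong swap (sym (lookup-index (∈-edges v<u (Adj-sym p))))

  edge→dart : ∀ o k → ∃[ d ] ends d ≡ orient o (edge k)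
  edge→dart true  k = dart _ _ (proj₂ (edge-property k)) , refl
  edge→dart false k = rev (dart _ _ (proj₂ (edge-property k))) , refl

  Dart↣Edge : Dart G ↣ (Fin (edgeCount G) × Bool)
  Dart↣Edge = mk↣ {to = λ d → let o , k , _ = dart→edge d in k , o} λ {d} {d′} eq →
    let _ , _ , p  = dart→edge d
        _ , _ , p′ = dart→edge d′
        tails , heads = ,-injective (trans (sym p) (trans (cong (λ (k , o) → orient o (edge k)) eq) p′))
    in dart-≡ tails heads

  Edge↣Dart : (Fin (edgeCount G) × Bool) ↣ Dart G
  Edge↣Dart = mk↣ {to = λ (k , o) → proj₁ (edge→dart o k)} λ {(k , o)} {(k′ , o′)} eq →
    injective k o k′ o′
      (trans (sym (proj₂ (edge→dart o k))) (trans (cong ends eq) (proj₂ (edge→dart o′ k′))))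
    where
    injective : ∀ k o k′ o′ → orient o (edge k) ≡ orient o′ (edge k′) → (k , o) ≡ (k′ , o′)
    injective k true  k′ true  eq = cong (_, true) (lookup-injective edges-unique eq)
    injective k false k′ false eq = cong (_, false) (lookup-injective edges-unique (cong swap eq))
    -- A listed pair has its smaller end first, so it is never the swap of a listed pair.
    injective k true  k′ false eq =
      contradiction (subst₂ _<_ (cong proj₂ (sym eq)) (cong proj₁ (sym eq)) (proj₁ (edge-property k′)))
                    (<-asym (proj₁ (edge-property k)))
    injective k false k′ true  eq =
      contradiction (subst₂ _<_ (cong proj₁ (sym eq)) (cong proj₂ (sym eq)) (proj₁ (edge-property k′)))
                    (<-asym (proj₁ (edge-property k)))

  edges×2 : Fin (edgeCount G ℕ.* 2) ↔ (Fin (edgeCount G) × Bool)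
  edges×2 = ↔-trans *↔× (↔-refl ×-↔ 2↔Bool)

  handshake : ∀ {k} → Fin k ↔ Dart G → k ≡ edgeCount G ℕ.* 2
  handshake α = ℕ.≤-antisym (↣⇒≤ α Dart↣Edge edges×2) (↣⇒≤ edges×2 Edge↣Dart α)

  module _ (v : Fin n) where

    neighbour : Fin (degree G v) → Fin n
    neighbour = lookup (filter (T? ∘ adj G v) (allFin n))

    neighbour-injective : Injective _≡_ _≡_ neighbour
    neighbour-injective = lookup-injective (filter⁺ (T? ∘ adj G v) (allFin⁺ n))

    neighbour-adjacent : ∀ k → Adj G v (neighbour k)
    neighbour-adjacent k = proj₂ (∈-filter⁻ (T? ∘ adj G v) {xs = allFin n} (∈-lookup k))

    ≤-degree : ∀ {k} (f : Fin k → Fin n) → Injective _≡_ _≡_ f → (∀ i → Adj G v (f i)) →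
               k ℕ.≤ degree G v
    ≤-degree f f-injective adjacent = injective⇒≤ {f = index} λ {i} {j} eq →
      f-injective (trans (lookup-index (f∈ i)) (trans (cong neighbour eq) (sym (lookup-index (f∈ j)))))
      where
      f∈ : ∀ i → f i ∈ _
      f∈ i = ∈-filter⁺ (T? ∘ adj G v) (∈-allFin (f i)) (adjacent i)
      index : _ → Fin (degree G v)
      index i = Any.index (f∈ i)

  -- `cycleAdj` is the union of the two directions around the cycle, and by symmetry of adjacency
  -- the forward one suffices.
  cycle-⊑ : ∀ {k} {3≤ℓ} (f : Fin (suc k) → Fin n) → Injective _≡_ _≡_ f →
            (∀ i j → suc (toℕ i) ℕ.% suc k ≡ toℕ j → Adj G (f i) (f j)) →
            C (suc k) {3≤ℓ} ⊑ G
  cycle-⊑ {k} f f-injective step = f , f-injective , hom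
    where
    hom : ∀ {i j} → T (cycleAdj (suc k) i j) → Adj G (f i) (f j)
    hom {i} {j} p with suc (toℕ i) ℕ.% suc k ℕ.≡ᵇ toℕ j in eq
    ... | true  = step i j (ℕ.≡ᵇ⇒≡ _ _ (subst T (sym eq) tt))
    ... | false = Adj-sym (step j i (ℕ.≡ᵇ⇒≡ _ _ p))

  triangle-⊑ : ∀ {a b c} → Adj G a b → Adj G b c → Adj G c a → C 3 ⊑ G
  triangle-⊑ {a} {b} {c} ab bc ca = cycle-⊑ f (lookup-injective distinct) step
    where
    vs = a ∷ b ∷ c ∷ []
    f = lookup vs
    distinct : Unique vs
    distinct = (Adj⇒≢ ab ∷ ≢-sym (Adj⇒≢ ca) ∷ []) ∷ (Adj⇒≢ bc ∷ []) ∷ [] ∷ []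
    step : ∀ i j → suc (toℕ i) ℕ.% 3 ≡ toℕ j → Adj G (f i) (f j)
    step 0F 1F _ = ab
    step 1F 2F _ = bc
    step 2F 0F _ = ca

  hexagon-⊑ : ∀ {a b c d e f} → Unique (a ∷ b ∷ c ∷ d ∷ e ∷ f ∷ []) →
              Adj G a b → Adj G b c → Adj G c d → Adj G d e → Adj G e f → Adj G f a → C 6 ⊑ G
  hexagon-⊑ {a} {b} {c} {d} {e} {f} distinct ab bc cd de ef fa =
    cycle-⊑ g (lookup-injective distinct) step
    where
    g = lookup (a ∷ b ∷ c ∷ d ∷ e ∷ f ∷ [])
    step : ∀ i j → suc (toℕ i) ℕ.% 6 ≡ toℕ j → Adj G (g i) (g j)
    step 0F 1F _ = ab
    step 1F 2F _ = bc
    step 2F 3F _ = cd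
    step 3F 4F _ = de
    step 4F 5F _ = ef
    step 5F 0F _ = fa

-- Iterates and orbits of a map

infixl 8 _^_
_^_ : {A : Set} → (A → A) → ℕ → A → A
(f ^ zero)  x = x
(f ^ suc k) x = f ((f ^ k) x)

module _ {A : Set} {f : A → A} where

  ^-suc : ∀ k x → (f ^ k) (f x) ≡ f ((f ^ k) x)
  ^-suc zero    x = refl
  ^-suc (suc k) x = cong f (^-suc k x)

  -- Cancelling `f` on both sides lowers both exponents until one is zero, and then the equation is
  -- a return to `x` in fewer than `p` steps.
  ^-injective : ∀ {p x} → Injective _≡_ _≡_ f → (∀ k → 0 ℕ.< k → k ℕ.< p → (f ^ k) x ≢ x) →
                ∀ {a b} → a ℕ.< p → b ℕ.< p → (f ^ a) x ≡ (f ^ b) x → a ≡ b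
  ^-injective f-inj aper {zero}  {zero}  _   _   _  = refl
  ^-injective f-inj aper {zero}  {suc b} _   b<p eq = contradiction (sym eq) (aper _ (s≤s z≤n) b<p)
  ^-injective f-inj aper {suc a} {zero}  a<p _   eq = contradiction eq (aper _ (s≤s z≤n) a<p)
  ^-injective f-inj aper {suc a} {suc b} a<p b<p eq =
    cong suc (^-injective f-inj aper (ℕ.<⇒≤ a<p) (ℕ.<⇒≤ b<p) (f-inj eq))

  -- `SameOrbit` also allows backward steps, hence the equivalence in the hypothesis.
  orbit-invariant : (P : A → Set) → (∀ x → P x ⇔ P (f x)) → ∀ {x y} → SameOrbit f x y → P x → P y
  orbit-invariant P inv xy = Equivalence.to (Eq.gfold ⇔-isEquivalence P (λ { refl → inv _ }) xy)

  ^-orbit : ∀ k x → SameOrbit f x ((f ^ k) x)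
  ^-orbit zero    x = Eq.reflexive _
  ^-orbit (suc k) x = Eq.transitive _ (^-orbit k x) (Eq.return refl)

abstract
  -- A face collects its twenty tokens as five from each of four darts or as four from each of five.
  -- Only the bijectivity of the two splittings matters, so they stay opaque.
  20↔4×5 : Fin 20 ↔ (Fin 4 × Fin 5)
  20↔4×5 = *↔×

  20↔5×4 : Fin 20 ↔ (Fin 5 × Fin 4)
  20↔5×4 = *↔×

-- The token count behind the upper bound

module UpperBound {n} {G : Graph n} (C₆-free : (C 6 isFree) G) (C₃-free : (C 3 isFree) G)
                  (degree≥3 : ∀ v → 3 ℕ.≤ degree G v) (R : RotationSystem G) where

  open GraphFacts G
  open RotationSystem R

  φ : Dart G → Dart G
  φ = nextOnFace

  rotate-injective : Injective _≡_ _≡_ rotate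
  rotate-injective = Injection.injective (↔⇒↣ rotation)

  φ-injective : Injective _≡_ _≡_ φ
  φ-injective {d} {d′} eq =
    trans (sym (rev-involutive d)) (trans (cong rev (rotate-injective eq)) (rev-involutive d′))

  tail-rotate : ∀ d → tail (rotate d) ≡ tail d
  tail-rotate d = sym (Equivalence.to (orbit⇔tail _ _) (Eq.return refl))

  tail-φ : ∀ d → tail (φ d) ≡ head d
  tail-φ d = tail-rotate (rev d)

  -- A rotation cycle of length at most two would exhaust the darts at a vertex.
  rotate²≢ : ∀ d → rotate (rotate d) ≢ d
  rotate²≢ d eq = contradiction (ℕ.≤-trans (degree≥3 v) (injective⇒≤ side-injective)) λ { (s≤s (s≤s ())) }
    where
    v = tail d
    P : Dart G → Set
    P x = x ≡ d ⊎ x ≡ rotate d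
    P-invariant : ∀ x → P x ⇔ P (rotate x)
    P-invariant x = mk⇔
      [ (λ p → inj₂ (cong rotate p)) , (λ p → inj₁ (trans (cong rotate p) eq)) ]′
      [ (λ p → inj₂ (rotate-injective (trans p (sym eq)))) , (λ p → inj₁ (rotate-injective p)) ]′
    at : Fin (degree G v) → Dart G
    at k = dart v (neighbour v k) (neighbour-adjacent v k)
    P-at : ∀ k → P (at k)
    P-at k = orbit-invariant P P-invariant (Equivalence.from (orbit⇔tail d (at k)) refl) (inj₁ refl)
    side : Fin (degree G v) → Fin 2
    side k = [ (λ _ → 0F) , (λ _ → 1F) ]′ (P-at k)
    side-injective : Injective _≡_ _≡_ side
    side-injective {i} {j} eq with P-at i | P-at j
    ... | inj₁ p | inj₁ q = neighbour-injective v (cong head (trans p (sym q)))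
    ... | inj₂ p | inj₂ q = neighbour-injective v (cong head (trans p (sym q)))
    side-injective () | inj₁ _ | inj₂ _
    side-injective () | inj₂ _ | inj₁ _

  rotate≢ : ∀ d → rotate d ≢ d
  rotate≢ d eq = rotate²≢ d (trans (cong rotate eq) eq)

  -- `φ d` leaves `head d`; if it led back to `tail d`, it would be `rev d`, and the rotation would
  -- fix `rev d`.
  head-φ≢tail : ∀ d → head (φ d) ≢ tail d
  head-φ≢tail d eq = rotate≢ (rev d) (dart-≡ (tail-φ d) eq)

  joined-to : ∀ (d : Dart G) {v} → head d ≡ v → Adj G (tail d) v
  joined-to d refl = Dart.joined d

  -- A return after one step gives a loop, after two steps a walk that turns straight back, after
  -- three steps a triangle.
  period≥4 : ∀ (d : Dart G) k → 0 ℕ.< k → k ℕ.< 4 → (φ ^ k) d ≢ d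
  period≥4 d 1 _ _ eq = Adj⇒≢ (Dart.joined d) (trans (sym (cong tail eq)) (tail-φ d))
  period≥4 d 2 _ _ eq = head-φ≢tail d (trans (sym (tail-φ (φ d))) (cong tail eq))
  period≥4 d 3 _ _ eq = C₃-free (triangle-⊑
    (joined-to d (sym (tail-φ d)))
    (joined-to (φ d) (sym (tail-φ (φ d))))
    (joined-to (φ (φ d)) (trans (sym (tail-φ _)) (cong tail eq))))
  period≥4 d (suc (suc (suc (suc _)))) _ (s≤s (s≤s (s≤s (s≤s ()))))

  -- By `period≥4` a return after four steps is the first one, so the face has length exactly four.
  record OnSquare (d : Dart G) : Set where
    constructor closed
    field closes : (φ ^ 4) d ≡ d

  open OnSquare

  abstract
    OnSquare? : ∀ d → Dec (OnSquare d)
    OnSquare? d = map′ (λ (p , q) → closed (dart-≡ p q)) (λ (closed p) → cong tail p , cong head p)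
                       ((tail ((φ ^ 4) d) ≟ tail d) ×-dec (head ((φ ^ 4) d) ≟ head d))

  OnSquare-φ : ∀ k {d} → OnSquare d → OnSquare ((φ ^ k) d)
  OnSquare-φ zero    square = square
  OnSquare-φ (suc k) square = closed (trans (^-suc {f = φ} 4 _) (cong φ (closes (OnSquare-φ k square))))

  OnSquare-φ⁻¹ : ∀ {d} → OnSquare (φ d) → OnSquare d
  OnSquare-φ⁻¹ {d} (closed p) = closed (φ-injective (trans (sym (^-suc {f = φ} 4 d)) p))

  module _ {d} (square : OnSquare d) where

    -- The corners of the square are, in order, `tail d`, `head d`, `head (φ d)` and
    -- `head (φ (φ d))`.
    square-closes : head (φ (φ (φ d))) ≡ tail d
    square-closes = trans (sym (tail-φ _)) (cong tail (closes square))

    square-side₁ : Adj G (head d) (head (φ d))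
    square-side₁ = subst (λ v → Adj G v (head (φ d))) (tail-φ d) (Dart.joined (φ d))

    square-side₂ : Adj G (head (φ d)) (head (φ (φ d)))
    square-side₂ = subst (λ v → Adj G v (head (φ (φ d)))) (tail-φ (φ d)) (Dart.joined (φ (φ d)))

    square-side₃ : Adj G (head (φ (φ d))) (tail d)
    square-side₃ = subst₂ (Adj G) (tail-φ (φ (φ d))) square-closes (Dart.joined (φ (φ (φ d))))

    square-diagonal : head d ≢ head (φ (φ d))
    square-diagonal eq = head-φ≢tail (φ d) (trans (sym eq) (sym (tail-φ d)))

    -- The two neighbours are the heads of rotate d and of the dart before d
    -- around its tail.
    square-neighbours≢ : head (φ (rev d)) ≢ head (φ (φ d))
    square-neighbours≢ eq = rotate²≢ d (trans (cong rotate rotate-d≡) (closes square))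
      where
      rotate-d≡ : rotate d ≡ rev (φ (φ (φ d)))
      rotate-d≡ = trans (cong rotate (sym (rev-involutive d)))
        (dart-≡ (trans (tail-φ (rev d)) (sym square-closes)) (trans eq (sym (tail-φ (φ (φ d))))))

  -- Two squares `a b c e` and `b a f g` on the edge `a b` leave the hexagon `a f g b c e` when that
  -- edge is removed. Of the coincidences between the two squares, `f = c` and `g = e` would create
  -- triangles, while `f = e` and `c = g` would create rotation cycles of length two.
  squares-share-no-edge : ∀ {d} → OnSquare d → ¬ OnSquare (rev d)
  squares-share-no-edge {d} square square′ = C₆-free (hexagon-⊑ {a = a} {f} {g} {b} {c} {e}
    ((Adj⇒≢ af ∷ square-diagonal square′ ∷ Adj⇒≢ ab ∷ ≢-sym (head-φ≢tail d) ∷ ≢-sym (Adj⇒≢ ea) ∷ [])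
     ∷ (Adj⇒≢ fg ∷ head-φ≢tail (rev d) ∷ f≢c ∷ square-neighbours≢ square ∷ [])
     ∷ (Adj⇒≢ gb ∷ ≢-sym c≢g ∷ g≢e ∷ [])
     ∷ (Adj⇒≢ bc ∷ square-diagonal square ∷ [])
     ∷ (Adj⇒≢ ce ∷ [])
     ∷ [] ∷ [])
    af fg gb bc ce ea)
    where
    a b c e f g : Fin n
    a = tail d
    b = head d
    c = head (φ d)
    e = head (φ (φ d))
    f = head (φ (rev d))
    g = head (φ (φ (rev d)))
    ab = Dart.joined d
    bc = square-side₁ square
    ce = square-side₂ square
    ea = square-side₃ square
    af = square-side₁ square′
    fg = square-side₂ square′
    gb = square-side₃ square′
    f≢c : f ≢ c
    f≢c eq = C₃-free (triangle-⊑ ab bc (subst (λ v → Adj G v a) eq (Adj-sym af)))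
    g≢e : g ≢ e
    g≢e eq = C₃-free (triangle-⊑ ab (Adj-sym gb) (subst (λ v → Adj G v a) (sym eq) ea))
    c≢g : c ≢ g
    c≢g = subst (λ d′ → head (φ d′) ≢ g) (rev-involutive d) (square-neighbours≢ square′)

  -- `rotate d` is `φ (rev d)`, so it bounds the same face as `rev d`, the face across the edge of
  -- `d`.
  square⇒rotate-not : ∀ {d} → OnSquare d → ¬ OnSquare (rotate d)
  square⇒rotate-not {d} square square′ = squares-share-no-edge square
    (OnSquare-φ⁻¹ (subst OnSquare (cong rotate (sym (rev-involutive d))) square′))

  record FreeDarts (v : Fin n) : Set where
    field
      free          : Fin 2 → Dart G
      free-tail     : ∀ i → tail (free i) ≡ v
      free-square   : ∀ i → ¬ OnSquare (free i)
      free-distinct : free 0F ≢ free 1F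

  -- Of two successive darts at `v` at least one is free. This yields a free dart `x`, and then a
  -- second one among the next two; neither of these is `x`, since the rotation has no cycle of
  -- length one or two.
  freeDarts : ∀ v → FreeDarts v
  freeDarts v = build (start (OnSquare? d))
    where
    k₀ : Fin (degree G v)
    k₀ with degree G v | degree≥3 v
    ... | suc _ | _ = zero
    d : Dart G
    d = dart v (neighbour v k₀) (neighbour-adjacent v k₀)
    FreeAt : Dart G → Set
    FreeAt x = tail x ≡ v × ¬ OnSquare x
    start : Dec (OnSquare d) → ∃[ x ] FreeAt x
    start (no ¬p) = d , refl , ¬p
    start (yes p) = rotate d , tail-rotate d , square⇒rotate-not p
    pair : ∀ x y → FreeAt x → FreeAt y → x ≢ y → FreeDarts v
    pair x y (xt , xf) (yt , yf) x≢y = record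
      { free          = λ { 0F → x ; 1F → y }
      ; free-tail     = λ { 0F → xt ; 1F → yt }
      ; free-square   = λ { 0F → xf ; 1F → yf }
      ; free-distinct = x≢y
      }
    build : ∃[ x ] FreeAt x → FreeDarts v
    build (x , xt , xf) with OnSquare? (rotate x)
    ... | no ¬p = pair x (rotate x) (xt , xf) (trans (tail-rotate x) xt , ¬p) (≢-sym (rotate≢ x))
    ... | yes p = pair x (rotate (rotate x)) (xt , xf)
      (trans (tail-rotate _) (trans (tail-rotate x) xt) , square⇒rotate-not p) (≢-sym (rotate²≢ x))

  module _ {f} (faces : HasSize Faces f) where

    open Inverse faces using () renaming (to to face; from to corner; to-cong to face-cong)

    face-corner : ∀ i → face (corner i) ≡ i
    face-corner = Inverse.strictlyInverseˡ faces

    private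
      module Free v = FreeDarts (freeDarts v)

    -- Every dart has five tokens.  A face of length four takes all of those of its
    -- darts, a longer one takes the first four of five consecutive darts, and a
    -- vertex takes the fifth token of two of its darts that lie on no square.
    Claim : Set
    Claim = (Fin f × Fin 20) ⊎ (Fin n × Fin 2)

    onSquare : Fin 4 × Fin 5 → Dart G → Dart G × Fin 5
    onSquare (a , b) r = (φ ^ toℕ a) r , b

    offSquare : Fin 5 × Fin 4 → Dart G → Dart G × Fin 5
    offSquare (a , b) r = (φ ^ toℕ a) r , inject₁ b

    claim-face : (r : Dart G) → Dec (OnSquare r) → Fin 20 → Dart G × Fin 5
    claim-face r (yes _) k = onSquare (Inverse.to 20↔4×5 k) r
    claim-face r (no _)  k = offSquare (Inverse.to 20↔5×4 k) r

    claim : Claim → Dart G × Fin 5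
    claim (inj₁ (i , k)) = claim-face (corner i) (OnSquare? (corner i)) k
    claim (inj₂ (v , b)) = Free.free v b , 4F

    claim-face-orbit : ∀ r dec k → SameOrbit φ r (proj₁ (claim-face r dec k))
    claim-face-orbit r (yes _) k = ^-orbit (toℕ (proj₁ (Inverse.to 20↔4×5 k))) r
    claim-face-orbit r (no _)  k = ^-orbit (toℕ (proj₁ (Inverse.to 20↔5×4 k))) r

    -- The darts used are iterates of `r` before its first return, which takes at least four steps
    -- on a square and at least five elsewhere.
    claim-face-injective : ∀ r dec → Injective _≡_ _≡_ (claim-face r dec)
    claim-face-injective r (yes _) eq = Injection.injective (↔⇒↣ 20↔4×5)
      (×-≡,≡→≡ (toℕ-injective (^-injective φ-injective (period≥4 r) (toℕ<n _) (toℕ<n _)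
                               (cong proj₁ eq)) ,
                cong proj₂ eq))
    claim-face-injective r (no ¬sq) eq = Injection.injective (↔⇒↣ 20↔5×4)
      (×-≡,≡→≡ (toℕ-injective (^-injective φ-injective period≥5 (toℕ<n _) (toℕ<n _)
                               (cong proj₁ eq)) ,
                inject₁-injective (cong proj₂ eq)))
      where
      period≥5 : ∀ k → 0 ℕ.< k → k ℕ.< 5 → (φ ^ k) r ≢ r
      period≥5 k 0<k (s≤s k≤4) with ℕ.m≤n⇒m<n∨m≡n k≤4
      ... | inj₁ k<4  = period≥4 r k 0<k k<4
      ... | inj₂ refl = ¬sq ∘ closed

    -- A square claims only darts on squares, and a longer face never claims the last token `4F`, as
    -- `inject₁` misses it.
    claim-face≢free : ∀ r dec k d → ¬ OnSquare d → claim-face r dec k ≢ (d , 4F)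
    claim-face≢free r (yes sq) k d ¬sq eq =
      ¬sq (subst OnSquare (cong proj₁ eq) (OnSquare-φ (toℕ (proj₁ (Inverse.to 20↔4×5 k))) sq))
    claim-face≢free r (no _)   k d ¬sq eq = fromℕ≢inject₁ (sym (cong proj₂ eq))

    face-claim-face : ∀ i dec k → face (proj₁ (claim-face (corner i) dec k)) ≡ i
    face-claim-face i dec k =
      trans (sym (face-cong (claim-face-orbit (corner i) dec k))) (face-corner i)

    face-claims : ∀ {i k i′ k′} → i ≡ i′ → claim (inj₁ (i , k)) ≡ claim (inj₁ (i′ , k′)) → (i , k) ≡ (i′ , k′)
    face-claims {i} refl eq = cong (i ,_) (claim-face-injective (corner i) (OnSquare? (corner i)) eq)

    vertex-claims : ∀ {v b v′ b′} → v ≡ v′ → Free.free v b ≡ Free.free v′ b′ → (v , b) ≡ (v′ , b′)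
    vertex-claims {b = 0F} {b′ = 0F} refl _  = refl
    vertex-claims {b = 1F} {b′ = 1F} refl _  = refl
    vertex-claims {v} {0F} {b′ = 1F} refl eq = contradiction eq (Free.free-distinct v)
    vertex-claims {v} {1F} {b′ = 0F} refl eq = contradiction (sym eq) (Free.free-distinct v)

    claim-injective : Injective _≡_ _≡_ claim
    claim-injective {inj₁ (i , k)} {inj₁ (i′ , k′)} eq = cong inj₁ (face-claims
      (trans (sym (face-claim-face i (OnSquare? (corner i)) k))
             (trans (cong (face ∘ proj₁) eq) (face-claim-face i′ (OnSquare? (corner i′)) k′)))
      eq)
    claim-injective {inj₁ (i , k)} {inj₂ (v , b)} eq =
      contradiction eq (claim-face≢free (corner i) (OnSquare? (corner i)) k (Free.free v b) (Free.free-square v b))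
    claim-injective {inj₂ (v , b)} {inj₁ (i , k)} eq =
      contradiction (sym eq) (claim-face≢free (corner i) (OnSquare? (corner i)) k (Free.free v b) (Free.free-square v b))
    claim-injective {inj₂ (v , b)} {inj₂ (v′ , b′)} eq = cong inj₂ (vertex-claims
      (trans (sym (Free.free-tail v b)) (trans (cong (tail ∘ proj₁) eq) (Free.free-tail v′ b′)))
      (cong proj₁ eq))

    tokens-suffice : f ℕ.* 20 ℕ.+ n ℕ.* 2 ℕ.≤ edgeCount G ℕ.* 2 ℕ.* 5
    tokens-suffice = ↣⇒≤
      (↔-trans +↔⊎ (*↔× ⊎-↔ *↔×))
      ((Dart↣Edge ×-↣ ↣-id (Fin 5)) ↣-∘ mk↣ claim-injective)
      (↔-trans *↔× (edges×2 ×-↔ ↔-refl))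

-- Minimum degree, rounding and the bound from Euler's formula

module _ {n} (G : Graph n) where

  δ⇒degree : ∀ {k} → k ℕ.≤ δ G → ∀ v → k ℕ.≤ degree G v
  δ⇒degree k≤δ v = ℕ.≤-trans k≤δ
    (All.lookup (min≤xs n (map (degree G) (allFin n))) (∈-map⁺ (degree G) (∈-allFin v)))

  -- The bound `k ≤ n` accounts for the default value `n` of the minimum in `δ`.
  degree⇒δ : ∀ {k} → k ℕ.≤ n → (∀ v → k ℕ.≤ degree G v) → k ℕ.≤ δ G
  degree⇒δ k≤n k≤degree = v≤min⁺ k≤n (All.map⁺ {xs = allFin n} (All.tabulate λ {v} _ → k≤degree v))

  no-isolated : (∀ v → 3 ℕ.≤ degree G v) → isolatedCount G ≡ 0
  no-isolated degree≥3 = cong length (filter-none (λ v → degree G v ℕ.≟ 0) {allFin n} (All.tabulate λ {v} _ eq →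
    contradiction (subst (3 ℕ.≤_) eq (degree≥3 v)) λ ()))

-- The left side is the numerator over the denominator 5 to which the unnormalised rational
-- expression computes.
floor-numerator : ∀ n k → 9 ℕ.* n ≡ 20 ℕ.+ k → (+ 9 ℤ.* + n) ℤ.* + 1 ℤ.+ ℤ.- (+ 4) ℤ.* + 5 ≡ + k
floor-numerator n k eq = begin
  (+ 9 ℤ.* + n) ℤ.* + 1 ℤ.+ ℤ.- (+ 20) ≡⟨ cong (ℤ._+ ℤ.- (+ 20)) (ℤ.*-identityʳ (+ 9 ℤ.* + n)) ⟩
  + 9 ℤ.* + n ℤ.+ ℤ.- (+ 20)           ≡⟨ cong (ℤ._+ ℤ.- (+ 20)) (sym (ℤ.pos-* 9 n)) ⟩
  + (9 ℕ.* n) ℤ.+ ℤ.- (+ 20)           ≡⟨ cong (λ x → + x ℤ.+ ℤ.- (+ 20)) eq ⟩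
  + (20 ℕ.+ k) ℤ.+ ℤ.- (+ 20)          ≡⟨⟩
  + k                                  ∎
  where open ≡-Reasoning

floor-value : ∀ n k → 9 ℕ.* n ≡ 20 ℕ.+ k →
              floor (+ 9 / 5 * (+ n / 1) - + 4 / 1) ≡ + (k ℕ./ 5)
-- Integer division multiplies the natural quotient by the sign of the divisor, here the factor
-- `+ 1`.
floor-value n k eq = trans (cong (ℤ._/ + 5) (floor-numerator n k eq)) (ℤ.*-identityˡ (+ (k ℕ./ 5)))

-- Twenty times Euler's formula bounds `20 f` from below, the tokens bound it from above. Doubling
-- both sides and adding `10 e` avoids subtraction of naturals.
euler-bound : ∀ {n f e c} → f ℕ.* 20 ℕ.+ n ℕ.* 2 ℕ.≤ e ℕ.* 2 ℕ.* 5 → 1 ℕ.≤ c →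
              n ℕ.+ (f ℕ.+ 0) ≡ e ℕ.+ 2 ℕ.* c → 20 ℕ.+ e ℕ.* 5 ℕ.≤ 9 ℕ.* n
euler-bound {n} {f} {e} {c} tokens 1≤c euler = ℕ.*-cancelˡ-≤ 2 (ℕ.+-cancelʳ-≤ (e ℕ.* 10) _ _ (begin
  2 ℕ.* (20 ℕ.+ e ℕ.* 5) ℕ.+ e ℕ.* 10         ≡⟨ solve 1 (λ e →
    con 2 :* (con 20 :+ e :* con 5) :+ e :* con 10 := con 20 :* (e :+ con 2 :* con 1)) refl e ⟩
  20 ℕ.* (e ℕ.+ 2 ℕ.* 1)                      ≤⟨ ℕ.*-monoʳ-≤ 20 (ℕ.+-monoʳ-≤ e (ℕ.*-monoʳ-≤ 2 1≤c)) ⟩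
  20 ℕ.* (e ℕ.+ 2 ℕ.* c)                      ≡⟨ cong (20 ℕ.*_) (sym euler) ⟩
  20 ℕ.* (n ℕ.+ (f ℕ.+ 0))                    ≡⟨ solve 2 (λ n f →
    con 20 :* (n :+ (f :+ con 0)) := con 2 :* (con 9 :* n) :+ (f :* con 20 :+ n :* con 2)) refl n f ⟩
  2 ℕ.* (9 ℕ.* n) ℕ.+ (f ℕ.* 20 ℕ.+ n ℕ.* 2)  ≤⟨ ℕ.+-monoʳ-≤ (2 ℕ.* (9 ℕ.* n)) tokens ⟩
  2 ℕ.* (9 ℕ.* n) ℕ.+ e ℕ.* 2 ℕ.* 5           ≡⟨ cong (2 ℕ.* (9 ℕ.* n) ℕ.+_) (ℕ.*-assoc e 2 5) ⟩
  2 ℕ.* (9 ℕ.* n) ℕ.+ e ℕ.* 10                ∎))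
  where
  open ℕ.≤-Reasoning
  open +-*-Solver

upper-bound : ∀ (n : ℕ) (G : Graph n) →
  (C 6 isFree) G → (C 3 isFree) G → Planar G → δ G ℕ.≥ 3 →
  + edgeCount G ≤ floor (+ 9 / 5 * (+ n / 1) - + 4 / 1)
-- The empty graph has `δ` equal to 0.
upper-bound zero    G C₆-free C₃-free planar ()
upper-bound n@(suc _) G C₆-free C₃-free (R , f , c , faces , components , euler) δ≥3 = begin
  + e                          ≡⟨ cong +_ (sym (ℕ.m*n/n≡m e 5)) ⟩
  + (e ℕ.* 5 ℕ./ 5)            ≤⟨ ℤ.+≤+ (ℕ./-monoˡ-≤ 5 (ℕ.m≤m+n (e ℕ.* 5) slack)) ⟩
  + ((e ℕ.* 5 ℕ.+ slack) ℕ./ 5) ≡⟨ sym (floor-value n _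
    (trans (sym (ℕ.m+[n∸m]≡n bound)) (ℕ.+-assoc 20 (e ℕ.* 5) slack))) ⟩
  floor (+ 9 / 5 * (+ n / 1) - + 4 / 1) ∎
  where
  open ℤ.≤-Reasoning
  e slack : ℕ
  e = edgeCount G
  degree≥3 : ∀ v → 3 ℕ.≤ degree G v
  degree≥3 = δ⇒degree G δ≥3
  1≤c : ∀ {c} → HasSize (Components G) c → 1 ℕ.≤ c
  1≤c {zero}  size = case Inverse.to size zero of λ ()
  1≤c {suc _} size = s≤s z≤n
  bound : 20 ℕ.+ e ℕ.* 5 ℕ.≤ 9 ℕ.* n
  bound = euler-bound {f = f} {e = e} {c = c}
    (UpperBound.tokens-suffice C₆-free C₃-free degree≥3 R faces) (1≤c components)
    (subst (λ i → n ℕ.+ (f ℕ.+ i) ≡ e ℕ.+ 2 ℕ.* c) (no-isolated G degree≥3) euler)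
  -- With this choice the numerator `9 n - 20` is `5 e + slack`, whose quotient by five is at least
  -- `e`.
  slack = 9 ℕ.* n ℕ.∸ (20 ℕ.+ e ℕ.* 5)

-- Cyclic permutations and ribbon graphs

cyc : ∀ {k} → Fin (suc k) → Fin (suc k)
cyc i with view i
... | ‵fromℕ     = zero
... | ‵inject₁ j = suc j

cyc⁻¹ : ∀ {k} → Fin (suc k) → Fin (suc k)
cyc⁻¹ zero    = fromℕ _
cyc⁻¹ (suc i) = inject₁ i

cyc-inject₁ : ∀ {k} (i : Fin k) → cyc (inject₁ i) ≡ suc i
cyc-inject₁ i rewrite view-inject₁ i = refl

cyc-cyc⁻¹ : ∀ {k} (i : Fin (suc k)) → cyc (cyc⁻¹ i) ≡ i
cyc-cyc⁻¹ {k} zero rewrite view-fromℕ k = refl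
cyc-cyc⁻¹ (suc i) = cyc-inject₁ i

cyc⁻¹-cyc : ∀ {k} (i : Fin (suc k)) → cyc⁻¹ (cyc i) ≡ i
cyc⁻¹-cyc i with view i
... | ‵fromℕ     = refl
... | ‵inject₁ j = refl

-- A splitting of `D` into cycles of `f`, indexed by `A`: `locate` and `element` are mutually
-- inverse, and `f` acts on each index range as `cyc`. Since cycles are nonempty, `size` is the
-- length minus one.
record Cycles {D : Set} (f : D → D) (A : Set) : Set where
  field
    size           : A → ℕ
    element        : (a : A) → Fin (suc (size a)) → D
    locate         : D → Σ[ a ∈ A ] Fin (suc (size a))
    element-locate : ∀ d → uncurry element (locate d) ≡ d
    locate-element : ∀ a i → locate (element a i) ≡ (a , i)
    step           : ∀ a i → f (element a i) ≡ element a (cyc i)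

  cycle : D → A
  cycle = proj₁ ∘ locate

  from-start : ∀ a i → SameOrbit f (element a zero) (element a i)
  from-start a = <-weakInduction _ (Eq.reflexive _) λ i start →
    Eq.transitive _ start (Eq.return (trans (step a (inject₁ i)) (cong (element a) (cyc-inject₁ i))))

  same-cycle : ∀ {d d′} → cycle d ≡ cycle d′ → SameOrbit f d d′
  same-cycle {d} {d′} eq = subst₂ (SameOrbit f) (element-locate d) (element-locate d′)
    (Eq.transitive _ (Eq.symmetric _ (from-start _ _))
      (subst (λ a → SameOrbit f (element a zero) (uncurry element (locate d′))) (sym eq) (from-start _ _)))

  cycle-step : ∀ d → cycle (f d) ≡ cycle d
  cycle-step d = begin
    cycle (f d)                                ≡⟨ cong (cycle ∘ f) (element-locate d) ⟨
    cycle (f (uncurry element (locate d)))     ≡⟨ cong cycle (step _ _) ⟩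
    cycle (element (cycle d) (cyc (proj₂ (locate d)))) ≡⟨ cong proj₁ (locate-element _ _) ⟩
    cycle d                                    ∎
    where open ≡-Reasoning

  orbits : Inverse (Orbits f) (setoid A)
  orbits = record
    { to        = cycle
    ; from      = λ a → element a zero
    ; to-cong   = to-cong
    ; from-cong = λ { refl → Eq.reflexive _ }
    ; inverse   = (λ {a} eq → trans (to-cong eq) (cong proj₁ (locate-element a zero)))
                , (λ { {d} refl → same-cycle (cong proj₁ (locate-element (cycle d) zero)) })
    }
    where
    to-cong : ∀ {d d′} → SameOrbit f d d′ → cycle d ≡ cycle d′
    to-cong = Eq.gfold isEquivalence cycle (λ { {d} refl → sym (cycle-step d) })

  size-orbits : ∀ {k} → A ↔ Fin k → HasSize (Orbits f) k
  size-orbits = Compose.inverse orbits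

-- Conjugate maps have corresponding cycles; this carries rotation and face cycles from half-edges
-- to darts.
transport-cycles : ∀ {D D′ A : Set} {f : D → D} {f′ : D′ → D′} (β : D′ ↔ D) →
  (∀ d → Inverse.to β (f′ d) ≡ f (Inverse.to β d)) → Cycles f A → Cycles f′ A
transport-cycles {f = f} {f′} β conjugate cycles = record
  { size           = size
  ; element        = λ a → from ∘ element a
  ; locate         = locate ∘ to
  ; element-locate = λ d → trans (cong from (element-locate (to d))) (strictlyInverseʳ d)
  ; locate-element = λ a i → trans (cong locate (strictlyInverseˡ _)) (locate-element a i)
  ; step           = λ a i → begin
      f′ (from (element a i))               ≡⟨ strictlyInverseʳ _ ⟨
      from (to (f′ (from (element a i))))   ≡⟨ cong from (conjugate _) ⟩
      from (f (to (from (element a i))))    ≡⟨ cong (from ∘ f) (strictlyInverseˡ _) ⟩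
      from (f (element a i))                ≡⟨ cong from (step a i) ⟩
      from (element a (cyc i))              ∎
  }
  where
  open Cycles cycles
  open Inverse β
  open ≡-Reasoning

-- A map given by its vertices, the cyclically ordered half-edges (v , s) at each
-- vertex v, and the involution exchanging the two halves of an edge.
record Ribbon : Set₁ where
  field
    Vertex : Set
    deg-1  : Vertex → ℕ

  Half : Set
  Half = Σ[ v ∈ Vertex ] Fin (suc (deg-1 v))

  field
    flip      : Half → Half
    flip-flip : ∀ d → flip (flip d) ≡ d

  origin : Half → Vertex
  origin = proj₁

  target : Half → Vertex
  target d = origin (flip d)

  field
    loopless : ∀ d → target d ≢ origin d
    simple   : ∀ v {s s′} → target (v , s) ≡ target (v , s′) → s ≡ s′

  turn face-turn : Half → Half
  turn (v , s) = v , cyc s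
  face-turn = turn ∘ flip

  Linked : Vertex → Vertex → Set
  Linked u v = ∃[ s ] target (u , s) ≡ v

  linked-sym : ∀ {u v} → Linked u v → Linked v u
  linked-sym {u} (s , refl) = proj₂ (flip (u , s)) , cong origin (flip-flip (u , s))

  -- A closed walk of length three that turns back at no later vertex turns back at its start. Only
  -- vertices two steps apart are compared, a local condition that can be tested after folding,
  -- where distant vertices may coincide.
  NoTriangle : Set
  NoTriangle = ∀ {v₀ v₁ v₂} → Linked v₀ v₁ → Linked v₁ v₂ → Linked v₂ v₀ →
    v₂ ≢ v₀ → v₀ ≢ v₁ → v₂ ≡ v₁

  NoHexagon : Set
  NoHexagon = ∀ {v₀ v₁ v₂ v₃ v₄ v₅} →
    Linked v₀ v₁ → Linked v₁ v₂ → Linked v₂ v₃ → Linked v₃ v₄ → Linked v₄ v₅ → Linked v₅ v₀ →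
    v₂ ≢ v₀ → v₃ ≢ v₁ → v₄ ≢ v₂ → v₅ ≢ v₃ → v₀ ≢ v₄ → v₅ ≡ v₁

  half-≡ : ∀ {d d′} → origin d ≡ origin d′ → target d ≡ target d′ → d ≡ d′
  half-≡ {v , _} refl eq = cong (v ,_) (simple v eq)

  turning : Half ↔ Half
  turning = mk↔ₛ′ turn (λ (v , s) → v , cyc⁻¹ s)
    (λ (v , s) → cong (v ,_) (cyc-cyc⁻¹ s)) (λ (v , s) → cong (v ,_) (cyc⁻¹-cyc s))

  turn-cycles : Cycles turn Vertex
  turn-cycles = record
    { size           = deg-1
    ; element        = _,_
    ; locate         = id
    ; element-locate = λ _ → refl
    ; locate-element = λ _ _ → refl
    ; step           = λ _ _ → refl
    }

-- The graph of a ribbon graph, with its rotation system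

module RibbonGraph (ρ : Ribbon) {n} (code : Ribbon.Vertex ρ ↔ Fin n) where

  open Ribbon ρ
  open Inverse code using () renaming
    (to to label; from to vertex; strictlyInverseˡ to label-vertex; strictlyInverseʳ to vertex-label)

  Joined : Fin n → Fin n → Set
  Joined u v = ∃[ s ] label (target (vertex u , s)) ≡ v

  joined⇒linked : ∀ {u v} → Joined u v → Linked (vertex u) (vertex v)
  joined⇒linked (s , refl) = s , sym (vertex-label _)

  linked⇒joined : ∀ {u v} → Linked (vertex u) (vertex v) → Joined u v
  linked⇒joined (s , eq) = s , trans (cong label eq) (label-vertex _)

  joined? : ∀ u v → Dec (Joined u v)
  joined? u v = any? λ s → label (target (vertex u , s)) ≟ v

  joined-sym : ∀ {u v} → Joined u v → Joined v u
  joined-sym = linked⇒joined ∘ linked-sym ∘ joined⇒linked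

  graph : Graph n
  graph = record
    { adj        = λ u v → does (joined? u v)
    ; adj-sym    = λ u v → does-⇔ (mk⇔ joined-sym joined-sym) (joined? u v) (joined? v u)
    ; adj-irrefl = λ v → dec-false (joined? v v) λ j →
        let s , eq = joined⇒linked j in loopless (vertex v , s) eq
    }

  open GraphFacts graph

  joined⇒Adj : ∀ {u v} → Joined u v → Adj graph u v
  joined⇒Adj {u} {v} = subst T (isYes≗does (joined? u v)) ∘ fromWitness

  Adj⇒joined : ∀ {u v} → Adj graph u v → Joined u v
  Adj⇒joined {u} {v} = toWitness ∘ subst T (sym (isYes≗does (joined? u v)))

  label-linked : ∀ {u v} → Linked u v → Adj graph (label u) (label v)
  label-linked link = joined⇒Adj (linked⇒joined
    (subst₂ Linked (sym (vertex-label _)) (sym (vertex-label _)) link))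

  Adj⇒linked : ∀ {u v} → Adj graph u v → Linked (vertex u) (vertex v)
  Adj⇒linked = joined⇒linked ∘ Adj⇒joined

  half : Dart graph → Half
  half (dart u v p) = vertex u , proj₁ (Adj⇒linked p)

  target-half : ∀ d → target (half d) ≡ vertex (head d)
  target-half (dart u v p) = proj₂ (Adj⇒linked p)

  dart-of : Half → Dart graph
  dart-of d = dart (label (origin d)) (label (target d)) (label-linked (proj₂ d , refl))

  -- By `simple` a half-edge is determined by its origin and target, just as a dart is by its ends.
  Dart↔Half : Dart graph ↔ Half
  Dart↔Half = mk↔ₛ′ half dart-of
    (λ d → half-≡ (vertex-label (origin d)) (trans (target-half (dart-of d)) (vertex-label (target d))))
    (λ d → dart-≡ (label-vertex (tail d)) (trans (cong label (target-half d)) (label-vertex (head d))))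

  half-rev : ∀ d → half (rev d) ≡ flip (half d)
  half-rev d = half-≡ (sym (target-half d))
    (trans (target-half (rev d)) (sym (cong origin (flip-flip (half d)))))

  open Inverse Dart↔Half using () renaming (strictlyInverseˡ to half-dart-of)

  rotation↔ : Dart graph ↔ Dart graph
  rotation↔ = ↔-trans Dart↔Half (↔-trans turning (↔-sym Dart↔Half))

  rotation-cycles : Cycles (Inverse.to rotation↔) Vertex
  rotation-cycles = transport-cycles Dart↔Half (λ d → half-dart-of (turn (half d))) turn-cycles

  rotationSystem : RotationSystem graph
  rotationSystem = record
    { rotation   = rotation↔
    ; orbit⇔tail = λ d d′ → mk⇔
        (Eq.gfold isEquivalence tail (λ { {d} refl → sym (label-vertex (tail d)) }))
        (λ eq → Cycles.same-cycle rotation-cycles (cong vertex eq))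
    }

  open RotationSystem rotationSystem using (nextOnFace; Faces)

  half-nextOnFace : ∀ d → half (nextOnFace d) ≡ face-turn (half d)
  half-nextOnFace d = trans (half-dart-of _) (cong turn (half-rev d))

  faces-size : ∀ {F k} → Cycles face-turn F → F ↔ Fin k → HasSize Faces k
  faces-size cycles = Cycles.size-orbits (transport-cycles Dart↔Half half-nextOnFace cycles)

  connected : ∀ base → (∀ v → EqClosure Linked base v) → HasSize (Components graph) 1
  connected base reach = record
    { to        = const 0F
    ; from      = const (label base)
    ; to-cong   = const refl
    ; from-cong = λ { refl → Eq.reflexive _ }
    ; inverse   = (λ { {0F} _ → refl })
                , (λ { {v} _ → subst (EqClosure (Adj graph) (label base)) (label-vertex v)
                       (Eq.gmap label label-linked (reach (vertex v))) })
    }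

  degree-≥ : ∀ v → suc (deg-1 (vertex v)) ℕ.≤ degree graph v
  degree-≥ v = ≤-degree v (λ s → label (target (vertex v , s)))
    (λ eq → simple (vertex v) (Injection.injective (↔⇒↣ code) eq))
    (λ s → joined⇒Adj (s , refl))

  module _ (2≤deg-1 : ∀ v → 2 ℕ.≤ deg-1 v) where

    degree≥3 : ∀ v → 3 ℕ.≤ degree graph v
    degree≥3 v = ℕ.≤-trans (s≤s (2≤deg-1 (vertex v))) (degree-≥ v)

    δ≥3 : 3 ℕ.≤ n → δ graph ℕ.≥ 3
    δ≥3 3≤n = degree⇒δ graph 3≤n degree≥3

    module _ {e} (half-count : Half ↔ Fin (e ℕ.* 2)) where

      edgeCount≡ : edgeCount graph ≡ e
      edgeCount≡ = ℕ.*-cancelʳ-≡ _ _ 2 (sym (handshake (↔-sym (↔-trans Dart↔Half half-count))))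

      planar : ∀ {F f} → Cycles face-turn F → F ↔ Fin f → ∀ base → (∀ v → EqClosure Linked base v) →
               n ℕ.+ f ≡ e ℕ.+ 2 → Planar graph
      planar {f = f} cycles F↔ base reach euler =
        rotationSystem , f , 1 , faces-size cycles F↔ , connected base reach , (begin
          n ℕ.+ (f ℕ.+ isolatedCount graph) ≡⟨ cong (λ i → n ℕ.+ (f ℕ.+ i)) (no-isolated graph degree≥3) ⟩
          n ℕ.+ (f ℕ.+ 0)                   ≡⟨ cong (n ℕ.+_) (ℕ.+-identityʳ f) ⟩
          n ℕ.+ f                           ≡⟨ euler ⟩
          e ℕ.+ 2                           ≡⟨ cong (ℕ._+ 2) (sym edgeCount≡) ⟩
          edgeCount graph ℕ.+ 2             ∎)
        where open ≡-Reasoning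

      -- The hypothesis makes `9 n / 5 - 4` the integer `e`, so rounding loses nothing.
      extremal : 9 ℕ.* n ≡ 20 ℕ.+ e ℕ.* 5 →
                 + edgeCount graph ≡ floor (+ 9 / 5 * (+ n / 1) - + 4 / 1)
      extremal eq = trans (cong +_ (trans edgeCount≡ (sym (ℕ.m*n/n≡m e 5)))) (sym (floor-value n (e ℕ.* 5) eq))

  vertex-injective : Injective _≡_ _≡_ vertex
  vertex-injective = Injection.injective (↔⇒↣ (↔-sym code))

  module _ {k} {K : Graph k} (K⊑ : K ⊑ graph) where

    embedded : Fin k → Vertex
    embedded = vertex ∘ proj₁ K⊑

    embedded-linked : ∀ {i j} → Adj K i j → Linked (embedded i) (embedded j)
    embedded-linked ij = Adj⇒linked (proj₂ (proj₂ K⊑) ij)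

    embedded-≢ : ∀ {i j} → i ≢ j → embedded i ≢ embedded j
    embedded-≢ i≢j eq = i≢j (proj₁ (proj₂ K⊑) (vertex-injective eq))

  -- An embedded cycle is a closed walk that turns back nowhere, not even at its start.
  C₃-free : NoTriangle → (C 3 isFree) graph
  C₃-free no-triangle C⊑ = ≢ {2F} {1F} (λ ())
    (no-triangle (link {0F} {1F} tt) (link {1F} {2F} tt) (link {2F} {0F} tt) (≢ λ ()) (≢ λ ()))
    where
    link = embedded-linked {K = C 3} C⊑
    ≢ = embedded-≢ {K = C 3} C⊑

  C₆-free : NoHexagon → (C 6 isFree) graph
  C₆-free no-hexagon C⊑ = ≢ {5F} {1F} (λ ())
    (no-hexagon (link {0F} {1F} tt) (link {1F} {2F} tt) (link {2F} {3F} tt)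
                (link {3F} {4F} tt) (link {4F} {5F} tt) (link {5F} {0F} tt)
                (≢ λ ()) (≢ λ ()) (≢ λ ()) (≢ λ ()) (≢ λ ()))
    where
    link = embedded-linked {K = C 6} C⊑
    ≢ = embedded-≢ {K = C 6} C⊑

-- The extremal tubes

-- In column j of the tube, from bottom to top: the bottom square b and its spokes to a;
-- in period i the vertices x, r and l, y, with the rings w between successive periods;
-- the spokes from c to the top square t.  The vertices l and r are the left and right
-- corners of a square, joined to the r and l of the columns next to it, and w j lies
-- between the columns j and j + 1.
pattern a j   = j , inj₁ (inj₁ 0F)
pattern b j   = j , inj₁ (inj₁ 1F)
pattern c j   = j , inj₁ (inj₁ 2F)
pattern t j   = j , inj₁ (inj₁ 3F)
pattern r i j = j , inj₁ (inj₂ (0F , i))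
pattern l i j = j , inj₁ (inj₂ (1F , i))
pattern w g j = j , inj₂ (inj₁ g)
pattern x i j = j , inj₂ (inj₂ (0F , i))
pattern y i j = j , inj₂ (inj₂ (1F , i))

-- The squares are bottom, top, ring and belt; the pentagons foot, crown, lower and upper
-- lie between the columns j and j + 1.
pattern bottom    = inj₁ (inj₁ 0F)
pattern top       = inj₁ (inj₁ 1F)
pattern ring g j  = inj₁ (inj₂ (j , inj₁ g))
pattern belt i j  = inj₁ (inj₂ (j , inj₂ i))
pattern foot j    = inj₂ (j , inj₁ 0F)
pattern crown j   = inj₂ (j , inj₁ 1F)
pattern lower i j = inj₂ (j , inj₂ (0F , i))
pattern upper i j = inj₂ (j , inj₂ (1F , i))

module Tube (m : ℕ) where

  -- Vertices are split by degree three or four and faces by length four or five; sums and products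
  -- of `Fin` let the standard bijections count them.
  Kind₃ Kind₄ V F : Set
  Kind₃ = Fin 4 ⊎ (Fin 2 × Fin m)
  Kind₄ = Fin (1 ℕ.+ m) ⊎ (Fin 2 × Fin m)
  V     = Fin 4 × (Kind₃ ⊎ Kind₄)
  F     = (Fin 2 ⊎ (Fin 4 × (Fin (1 ℕ.+ m) ⊎ Fin m))) ⊎ (Fin 4 × (Fin 2 ⊎ (Fin 2 × Fin m)))

  deg-1 : V → ℕ
  deg-1 (_ , inj₁ _) = 2
  deg-1 (_ , inj₂ _) = 3

  H : Set
  H = Σ[ v ∈ V ] Fin (suc (deg-1 v))

  -- The half-edges at a vertex are numbered in rotation order. Above the ring `w g` lies `c` if `g`
  -- is the last index, otherwise an `x`; below it lies `a` if `g` is zero, otherwise a `y`.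
  flip : H → H
  flip (a j , 0F) = w 0F j , 2F
  flip (a j , 1F) = w 0F (cyc⁻¹ j) , 3F
  flip (a j , 2F) = b j , 1F
  flip (b j , 0F) = b (cyc j) , 2F
  flip (b j , 1F) = a j , 2F
  flip (b j , 2F) = b (cyc⁻¹ j) , 0F
  flip (c j , 0F) = t j , 2F
  flip (c j , 1F) = w (fromℕ m) (cyc⁻¹ j) , 0F
  flip (c j , 2F) = w (fromℕ m) j , 1F
  flip (t j , 0F) = t (cyc j) , 1F
  flip (t j , 1F) = t (cyc⁻¹ j) , 0F
  flip (t j , 2F) = c j , 0F
  flip (r i j , 0F) = l i (cyc j) , 0F
  flip (r i j , 1F) = y i j , 3F
  flip (r i j , 2F) = x i j , 0F
  flip (l i j , 0F) = r i (cyc⁻¹ j) , 0F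
  flip (l i j , 1F) = x i j , 1F
  flip (l i j , 2F) = y i j , 2F
  flip (w g j , 0F) with view g
  ... | ‵fromℕ     = c (cyc j) , 1F
  ... | ‵inject₁ i = x i (cyc j) , 2F
  flip (w g j , 1F) with view g
  ... | ‵fromℕ     = c j , 2F
  ... | ‵inject₁ i = x i j , 3F
  flip (w 0F      j , 2F) = a j , 0F
  flip (w (suc i) j , 2F) = y i j , 0F
  flip (w 0F      j , 3F) = a (cyc j) , 1F
  flip (w (suc i) j , 3F) = y i (cyc j) , 1F
  flip (x i j , 0F) = r i j , 2F
  flip (x i j , 1F) = l i j , 1F
  flip (x i j , 2F) = w (inject₁ i) (cyc⁻¹ j) , 0F
  flip (x i j , 3F) = w (inject₁ i) j , 1F
  flip (y i j , 0F) = w (suc i) j , 2F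
  flip (y i j , 1F) = w (suc i) (cyc⁻¹ j) , 3F
  flip (y i j , 2F) = l i j , 2F
  flip (y i j , 3F) = r i j , 1F

  flip-flip : ∀ d → flip (flip d) ≡ d
  flip-flip (a j , 0F) = refl
  flip-flip (a j , 1F) = cong (λ j → a j , 1F) (cyc-cyc⁻¹ j)
  flip-flip (a j , 2F) = refl
  flip-flip (b j , 0F) = cong (λ j → b j , 0F) (cyc⁻¹-cyc j)
  flip-flip (b j , 1F) = refl
  flip-flip (b j , 2F) = cong (λ j → b j , 2F) (cyc-cyc⁻¹ j)
  flip-flip (c j , 0F) = refl
  flip-flip (c j , 1F) rewrite view-fromℕ m = cong (λ j → c j , 1F) (cyc-cyc⁻¹ j)
  flip-flip (c j , 2F) rewrite view-fromℕ m = refl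
  flip-flip (t j , 0F) = cong (λ j → t j , 0F) (cyc⁻¹-cyc j)
  flip-flip (t j , 1F) = cong (λ j → t j , 1F) (cyc-cyc⁻¹ j)
  flip-flip (t j , 2F) = refl
  flip-flip (r i j , 0F) = cong (λ j → r i j , 0F) (cyc⁻¹-cyc j)
  flip-flip (r i j , 1F) = refl
  flip-flip (r i j , 2F) = refl
  flip-flip (l i j , 0F) = cong (λ j → l i j , 0F) (cyc-cyc⁻¹ j)
  flip-flip (l i j , 1F) = refl
  flip-flip (l i j , 2F) = refl
  flip-flip (w g j , 0F) with view g
  ... | ‵fromℕ     = cong (λ j → w (fromℕ m) j , 0F) (cyc⁻¹-cyc j)
  ... | ‵inject₁ i = cong (λ j → w (inject₁ i) j , 0F) (cyc⁻¹-cyc j)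
  flip-flip (w g j , 1F) with view g
  ... | ‵fromℕ     = refl
  ... | ‵inject₁ i = refl
  flip-flip (w 0F      j , 2F) = refl
  flip-flip (w (suc i) j , 2F) = refl
  flip-flip (w 0F      j , 3F) = cong (λ j → w 0F j , 3F) (cyc⁻¹-cyc j)
  flip-flip (w (suc i) j , 3F) = cong (λ j → w (suc i) j , 3F) (cyc⁻¹-cyc j)
  flip-flip (x i j , 0F) = refl
  flip-flip (x i j , 1F) = refl
  flip-flip (x i j , 2F) rewrite view-inject₁ i = cong (λ j → x i j , 2F) (cyc-cyc⁻¹ j)
  flip-flip (x i j , 3F) rewrite view-inject₁ i = refl
  flip-flip (y i j , 0F) = refl
  flip-flip (y i j , 1F) = cong (λ j → y i j , 1F) (cyc-cyc⁻¹ j)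
  flip-flip (y i j , 2F) = refl
  flip-flip (y i j , 3F) = refl

  turn : H → H
  turn (v , s) = v , cyc s

  size : F → ℕ
  size (inj₁ _) = 3
  size (inj₂ _) = 4

  side : (f : F) → Fin (suc (size f)) → H
  side bottom    k = b k , 0F
  -- The boundary walk of the top square passes the columns in decreasing order.
  side top       k = t (opposite k) , 1F
  side (ring g j) 0F = w g (cyc⁻¹ j) , 0F
  side (ring g j) 1F with view g
  ... | ‵fromℕ     = c j , 2F
  ... | ‵inject₁ i = x i j , 3F
  side (ring g j) 2F = w g j , 2F
  side (ring 0F j)      3F = a j , 1F
  side (ring (suc i) j) 3F = y i j , 1F
  side (belt i j) 0F = x i j , 1F
  side (belt i j) 1F = l i j , 2F
  side (belt i j) 2F = y i j , 3F
  side (belt i j) 3F = r i j , 2F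
  side (foot j) 0F = a j , 0F
  side (foot j) 1F = w 0F j , 3F
  side (foot j) 2F = a (cyc j) , 2F
  side (foot j) 3F = b (cyc j) , 2F
  side (foot j) 4F = b j , 1F
  side (crown j) 0F = w (fromℕ m) j , 1F
  side (crown j) 1F = c j , 0F
  side (crown j) 2F = t j , 0F
  side (crown j) 3F = t (cyc j) , 2F
  side (crown j) 4F = c (cyc j) , 1F
  side (lower i j) 0F = w (inject₁ i) j , 1F
  side (lower i j) 1F = x i j , 0F
  side (lower i j) 2F = r i j , 0F
  side (lower i j) 3F = l i (cyc j) , 1F
  side (lower i j) 4F = x i (cyc j) , 2F
  side (upper i j) 0F = y i j , 0F
  side (upper i j) 1F = w (suc i) j , 3F
  side (upper i j) 2F = y i (cyc j) , 2F
  side (upper i j) 3F = l i (cyc j) , 0F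
  side (upper i j) 4F = r i j , 1F

  face-of : H → Σ[ f ∈ F ] Fin (suc (size f))
  face-of (a j , 0F) = foot j , 0F
  face-of (a j , 1F) = ring 0F j , 3F
  face-of (a j , 2F) = foot (cyc⁻¹ j) , 2F
  face-of (b j , 0F) = bottom , j
  face-of (b j , 1F) = foot j , 4F
  face-of (b j , 2F) = foot (cyc⁻¹ j) , 3F
  face-of (c j , 0F) = crown j , 1F
  face-of (c j , 1F) = crown (cyc⁻¹ j) , 4F
  face-of (c j , 2F) = ring (fromℕ m) j , 1F
  face-of (t j , 0F) = crown j , 2F
  face-of (t j , 1F) = top , opposite j
  face-of (t j , 2F) = crown (cyc⁻¹ j) , 3F
  face-of (r i j , 0F) = lower i j , 2F
  face-of (r i j , 1F) = upper i j , 4F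
  face-of (r i j , 2F) = belt i j , 3F
  face-of (l i j , 0F) = upper i (cyc⁻¹ j) , 3F
  face-of (l i j , 1F) = lower i (cyc⁻¹ j) , 3F
  face-of (l i j , 2F) = belt i j , 1F
  face-of (w g j , 0F) = ring g (cyc j) , 0F
  face-of (w g j , 1F) with view g
  ... | ‵fromℕ     = crown j , 0F
  ... | ‵inject₁ i = lower i j , 0F
  face-of (w g j , 2F) = ring g j , 2F
  face-of (w 0F      j , 3F) = foot j , 1F
  face-of (w (suc i) j , 3F) = upper i j , 1F
  face-of (x i j , 0F) = lower i j , 1F
  face-of (x i j , 1F) = belt i j , 0F
  face-of (x i j , 2F) = lower i (cyc⁻¹ j) , 4F
  face-of (x i j , 3F) = ring (inject₁ i) j , 1F
  face-of (y i j , 0F) = upper i j , 0F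
  face-of (y i j , 1F) = ring (suc i) j , 3F
  face-of (y i j , 2F) = upper i (cyc⁻¹ j) , 2F
  face-of (y i j , 3F) = belt i j , 2F

  side-face-of : ∀ d → uncurry side (face-of d) ≡ d
  side-face-of (a j , 0F) = refl
  side-face-of (a j , 1F) = refl
  side-face-of (a j , 2F) = cong (λ j → a j , 2F) (cyc-cyc⁻¹ j)
  side-face-of (b j , 0F) = refl
  side-face-of (b j , 1F) = refl
  side-face-of (b j , 2F) = cong (λ j → b j , 2F) (cyc-cyc⁻¹ j)
  side-face-of (c j , 0F) = refl
  side-face-of (c j , 1F) = cong (λ j → c j , 1F) (cyc-cyc⁻¹ j)
  side-face-of (c j , 2F) rewrite view-fromℕ m = refl
  side-face-of (t j , 0F) = refl
  side-face-of (t j , 1F) = cong (λ j → t j , 1F) (opposite-involutive j)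
  side-face-of (t j , 2F) = cong (λ j → t j , 2F) (cyc-cyc⁻¹ j)
  side-face-of (r i j , 0F) = refl
  side-face-of (r i j , 1F) = refl
  side-face-of (r i j , 2F) = refl
  side-face-of (l i j , 0F) = cong (λ j → l i j , 0F) (cyc-cyc⁻¹ j)
  side-face-of (l i j , 1F) = cong (λ j → l i j , 1F) (cyc-cyc⁻¹ j)
  side-face-of (l i j , 2F) = refl
  side-face-of (w g j , 0F) = cong (λ j → w g j , 0F) (cyc⁻¹-cyc j)
  side-face-of (w g j , 1F) with view g
  ... | ‵fromℕ     = refl
  ... | ‵inject₁ i = refl
  side-face-of (w g j , 2F) = refl
  side-face-of (w 0F      j , 3F) = refl
  side-face-of (w (suc i) j , 3F) = refl
  side-face-of (x i j , 0F) = refl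
  side-face-of (x i j , 1F) = refl
  side-face-of (x i j , 2F) = cong (λ j → x i j , 2F) (cyc-cyc⁻¹ j)
  side-face-of (x i j , 3F) rewrite view-inject₁ i = refl
  side-face-of (y i j , 0F) = refl
  side-face-of (y i j , 1F) = refl
  side-face-of (y i j , 2F) = cong (λ j → y i j , 2F) (cyc-cyc⁻¹ j)
  side-face-of (y i j , 3F) = refl

  face-of-side : ∀ f k → face-of (side f k) ≡ (f , k)
  face-of-side bottom    k = refl
  face-of-side top       k = cong (top ,_) (opposite-involutive k)
  face-of-side (ring g j) 0F = cong (λ j → ring g j , 0F) (cyc-cyc⁻¹ j)
  face-of-side (ring g j) 1F with view g
  ... | ‵fromℕ     = refl
  ... | ‵inject₁ i = refl
  face-of-side (ring g j) 2F = refl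
  face-of-side (ring 0F j)      3F = refl
  face-of-side (ring (suc i) j) 3F = refl
  face-of-side (belt i j) 0F = refl
  face-of-side (belt i j) 1F = refl
  face-of-side (belt i j) 2F = refl
  face-of-side (belt i j) 3F = refl
  face-of-side (foot j) 0F = refl
  face-of-side (foot j) 1F = refl
  face-of-side (foot j) 2F = cong (λ j → foot j , 2F) (cyc⁻¹-cyc j)
  face-of-side (foot j) 3F = cong (λ j → foot j , 3F) (cyc⁻¹-cyc j)
  face-of-side (foot j) 4F = refl
  face-of-side (crown j) 0F rewrite view-fromℕ m = refl
  face-of-side (crown j) 1F = refl
  face-of-side (crown j) 2F = refl
  face-of-side (crown j) 3F = cong (λ j → crown j , 3F) (cyc⁻¹-cyc j)
  face-of-side (crown j) 4F = cong (λ j → crown j , 4F) (cyc⁻¹-cyc j)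
  face-of-side (lower i j) 0F rewrite view-inject₁ i = refl
  face-of-side (lower i j) 1F = refl
  face-of-side (lower i j) 2F = refl
  face-of-side (lower i j) 3F = cong (λ j → lower i j , 3F) (cyc⁻¹-cyc j)
  face-of-side (lower i j) 4F = cong (λ j → lower i j , 4F) (cyc⁻¹-cyc j)
  face-of-side (upper i j) 0F = refl
  face-of-side (upper i j) 1F = refl
  face-of-side (upper i j) 2F = cong (λ j → upper i j , 2F) (cyc⁻¹-cyc j)
  face-of-side (upper i j) 3F = cong (λ j → upper i j , 3F) (cyc⁻¹-cyc j)
  face-of-side (upper i j) 4F = refl

  side-step : ∀ f k → turn (flip (side f k)) ≡ side f (cyc k)
  side-step bottom    k = refl
  side-step top       0F = refl
  side-step top       1F = refl
  side-step top       2F = refl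
  side-step top       3F = refl
  side-step (ring g j) 0F with view g
  ... | ‵fromℕ     = cong (λ j → c j , 2F) (cyc-cyc⁻¹ j)
  ... | ‵inject₁ i = cong (λ j → x i j , 3F) (cyc-cyc⁻¹ j)
  side-step (ring g j) 1F with view g
  ... | ‵fromℕ     = refl
  ... | ‵inject₁ i = refl
  side-step (ring 0F j)      2F = refl
  side-step (ring (suc i) j) 2F = refl
  side-step (ring 0F j)      3F = refl
  side-step (ring (suc i) j) 3F = refl
  side-step (belt i j) 0F = refl
  side-step (belt i j) 1F = refl
  side-step (belt i j) 2F = refl
  side-step (belt i j) 3F = refl
  side-step (foot j) 0F = refl
  side-step (foot j) 1F = refl
  side-step (foot j) 2F = refl
  side-step (foot j) 3F = cong (λ j → b j , 1F) (cyc⁻¹-cyc j)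
  side-step (foot j) 4F = refl
  side-step (crown j) 0F rewrite view-fromℕ m = refl
  side-step (crown j) 1F = refl
  side-step (crown j) 2F = refl
  side-step (crown j) 3F = refl
  side-step (crown j) 4F = cong (λ j → w (fromℕ m) j , 1F) (cyc⁻¹-cyc j)
  side-step (lower i j) 0F rewrite view-inject₁ i = refl
  side-step (lower i j) 1F = refl
  side-step (lower i j) 2F = refl
  side-step (lower i j) 3F = refl
  side-step (lower i j) 4F = cong (λ j → w (inject₁ i) j , 1F) (cyc⁻¹-cyc j)
  side-step (upper i j) 0F = refl
  side-step (upper i j) 1F = refl
  side-step (upper i j) 2F = refl
  side-step (upper i j) 3F = cong (λ j → r i j , 1F) (cyc⁻¹-cyc j)
  side-step (upper i j) 4F = refl

  face-cycles : Cycles (turn ∘ flip) F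
  face-cycles = record
    { size           = size
    ; element        = side
    ; locate         = face-of
    ; element-locate = side-face-of
    ; locate-element = face-of-side
    ; step           = side-step
    }

  n e f : ℕ
  n = 4 ℕ.* ((4 ℕ.+ 2 ℕ.* m) ℕ.+ ((1 ℕ.+ m) ℕ.+ 2 ℕ.* m))
  e = 36 ℕ.* m ℕ.+ 32
  f = (2 ℕ.+ 4 ℕ.* ((1 ℕ.+ m) ℕ.+ m)) ℕ.+ 4 ℕ.* (2 ℕ.+ 2 ℕ.* m)

  V↔ : V ↔ Fin n
  V↔ = ↔-sym (↔-trans *↔× (↔-refl ×-↔ ↔-trans +↔⊎
    (↔-trans +↔⊎ (↔-refl ⊎-↔ *↔×) ⊎-↔ ↔-trans +↔⊎ (↔-refl ⊎-↔ *↔×))))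

  F↔ : F ↔ Fin f
  F↔ = ↔-sym (↔-trans +↔⊎
    ( ↔-trans +↔⊎ (↔-refl ⊎-↔ ↔-trans *↔× (↔-refl ×-↔ +↔⊎))
    ⊎-↔ ↔-trans *↔× (↔-refl ×-↔ ↔-trans +↔⊎ (↔-refl ⊎-↔ *↔×))))

  -- The range of `s` depends on the vertex only through its degree, so fixing the degree turns the
  -- dependent sum into products.
  H-by-degree : H ↔ (Fin 4 × ((Kind₃ × Fin 3) ⊎ (Kind₄ × Fin 4)))
  H-by-degree = mk↔ₛ′
    (λ { ((j , inj₁ k) , s) → j , inj₁ (k , s) ; ((j , inj₂ k) , s) → j , inj₂ (k , s) })
    (λ { (j , inj₁ (k , s)) → (j , inj₁ k) , s ; (j , inj₂ (k , s)) → (j , inj₂ k) , s })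
    (λ { (j , inj₁ (k , s)) → refl ; (j , inj₂ (k , s)) → refl })
    (λ { ((j , inj₁ k) , s) → refl ; ((j , inj₂ k) , s) → refl })

  H↔ : H ↔ Fin (4 ℕ.* ((4 ℕ.+ 2 ℕ.* m) ℕ.* 3 ℕ.+ ((1 ℕ.+ m) ℕ.+ 2 ℕ.* m) ℕ.* 4))
  H↔ = ↔-trans H-by-degree (↔-sym (↔-trans *↔× (↔-refl ×-↔ ↔-trans +↔⊎
    ( ↔-trans *↔× (↔-trans +↔⊎ (↔-refl ⊎-↔ *↔×) ×-↔ ↔-refl)
    ⊎-↔ ↔-trans *↔× (↔-trans +↔⊎ (↔-refl ⊎-↔ *↔×) ×-↔ ↔-refl)))))

  module Count where
    open +-*-Solver

    :n : ∀ {k} → Polynomial k → Polynomial k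
    :n m = con 4 :* ((con 4 :+ con 2 :* m) :+ ((con 1 :+ m) :+ con 2 :* m))

    :e : ∀ {k} → Polynomial k → Polynomial k
    :e m = con 36 :* m :+ con 32

    halves : 4 ℕ.* ((4 ℕ.+ 2 ℕ.* m) ℕ.* 3 ℕ.+ ((1 ℕ.+ m) ℕ.+ 2 ℕ.* m) ℕ.* 4) ≡ e ℕ.* 2
    halves = solve 1 (λ m →
      con 4 :* ((con 4 :+ con 2 :* m) :* con 3 :+ ((con 1 :+ m) :+ con 2 :* m) :* con 4) := :e m :* con 2) refl m

    euler : n ℕ.+ f ≡ e ℕ.+ 2
    euler = solve 1 (λ m →
      :n m :+ ((con 2 :+ con 4 :* ((con 1 :+ m) :+ m)) :+ con 4 :* (con 2 :+ con 2 :* m)) := :e m :+ con 2) refl m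

    tight : 9 ℕ.* n ≡ 20 ℕ.+ e ℕ.* 5
    tight = solve 1 (λ m → con 9 :* :n m := con 20 :+ :e m :* con 5) refl m

    linear : n ≡ m ℕ.+ (20 ℕ.+ 19 ℕ.* m)
    linear = solve 1 (λ m → :n m := m :+ (con 20 :+ con 19 :* m)) refl m

-- Hexagon-freeness by folding

-- The components are the column, the level modulo two and one of the nine kinds of vertex.
Folded : Set
Folded = Fin 4 × Fin 2 × Fin 9

pattern ‵a p j = j , p , 0F
pattern ‵b p j = j , p , 1F
pattern ‵c p j = j , p , 2F
pattern ‵t p j = j , p , 3F
pattern ‵r p j = j , p , 4F
pattern ‵l p j = j , p , 5F
pattern ‵w p j = j , p , 6F
pattern ‵x p j = j , p , 7F
pattern ‵y p j = j , p , 8F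

_≟ᶠ_ : DecidableEquality Folded
_≟ᶠ_ = ≡-dec _≟_ (≡-dec _≟_ _≟_)

allFolded? : ∀ {P : Folded → Set} → Decidable P → Dec (∀ j p k → P (j , p , k))
allFolded? P? = all? λ j → all? λ p → all? λ k → P? (j , p , k)

-- The graph onto which the tube folds when levels are taken modulo two, with caps
-- attached at every ring so that it does not depend on the length of the tube.
around : Folded → List Folded
around (‵a p j) = ‵w p j ∷ ‵w p (cyc⁻¹ j) ∷ ‵b p j ∷ []
around (‵b p j) = ‵b p (cyc j) ∷ ‵a p j ∷ ‵b p (cyc⁻¹ j) ∷ []
around (‵c p j) = ‵t p j ∷ ‵w p (cyc⁻¹ j) ∷ ‵w p j ∷ []
around (‵t p j) = ‵t p (cyc j) ∷ ‵t p (cyc⁻¹ j) ∷ ‵c p j ∷ []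
around (‵r p j) = ‵l p (cyc j) ∷ ‵y p j ∷ ‵x p j ∷ []
around (‵l p j) = ‵r p (cyc⁻¹ j) ∷ ‵x p j ∷ ‵y p j ∷ []
around (‵w p j) = ‵x p (cyc j) ∷ ‵x p j ∷ ‵y (cyc⁻¹ p) j ∷ ‵y (cyc⁻¹ p) (cyc j)
                ∷ ‵c p (cyc j) ∷ ‵c p j ∷ ‵a p j ∷ ‵a p (cyc j) ∷ []
around (‵x p j) = ‵r p j ∷ ‵l p j ∷ ‵w p (cyc⁻¹ j) ∷ ‵w p j ∷ []
around (‵y p j) = ‵w (cyc p) j ∷ ‵w (cyc p) (cyc⁻¹ j) ∷ ‵l p j ∷ ‵r p j ∷ []

-- Checked on all 72 vertices. The absence of loops and of repeated neighbours passes to the tube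
-- through `fold`.
around-unique : ∀ q → Unique (q ∷ around q)
around-unique (j , p , k) =
  toWitness {a? = allFolded? λ q → DecUnique.unique? _≟ᶠ_ (q ∷ around q)} tt j p k

folded : List Folded
folded = cartesianProduct (allFin 4) (cartesianProduct (allFin 2) (allFin 9))

∈-folded : ∀ q → q ∈ folded
∈-folded (j , p , k) = ∈-cartesianProduct⁺ (∈-allFin j) (∈-cartesianProduct⁺ (∈-allFin p) (∈-allFin k))

-- A walk that has left start for next and has just moved from q to q′ cannot, without
-- turning back on the spot, be at start after k more steps unless it arrives from next.
noReturn : ℕ → (start next q q′ : Folded) → Bool
noReturn zero    start next q q′ = does (¬? (q′ ≟ᶠ start)) ∨ does (q ≟ᶠ next)
noReturn (suc k) start next q q′ =
  all (λ q″ → does (q″ ≟ᶠ q) ∨ noReturn k start next q′ q″) (around q′)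

noClosedWalk : ℕ → Bool
noClosedWalk k = all (λ q → all (λ next → noReturn k q next q next) (around q)) folded

∨-right : ∀ {A : Set} {x} (A? : Dec A) → T (does A? ∨ x) → ¬ A → T x
∨-right (yes p) _  ¬p = contradiction p ¬p
∨-right (no _)  tx _  = tx

¬∨⇒ : ∀ {A B : Set} (A? : Dec A) (B? : Dec B) → T (does (¬? A?) ∨ does B?) → A → B
¬∨⇒ (no ¬p) _       _ p = contradiction p ¬p
¬∨⇒ (yes _) (yes q) _ _ = q

record NoReturn (k : ℕ) (start next q q′ : Folded) : Set where
  constructor checked
  field holds : T (noReturn k start next q q′)

noReturn-step : ∀ {k start next q q′ q″} → NoReturn (suc k) start next q q′ →
                q″ ∈ around q′ → q″ ≢ q → NoReturn k start next q′ q″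
noReturn-step {k} {start} {next} {q} {q′} {q″} (checked safe) q″∈ q″≢q = checked (∨-right (q″ ≟ᶠ q)
  (All.lookup (All.all⁺ (λ q″ → does (q″ ≟ᶠ q) ∨ noReturn k start next q′ q″) (around q′) safe) q″∈) q″≢q)

noReturn-end : ∀ {start next q} → NoReturn 0 start next q start → q ≡ next
noReturn-end {start} {next} {q} (checked safe) = ¬∨⇒ (start ≟ᶠ start) (q ≟ᶠ next) safe refl

noReturn-start : ∀ k → noClosedWalk k ≡ true → ∀ {q next} → next ∈ around q → NoReturn k q next q next
noReturn-start k eq {q} next∈ = checked (All.lookup (All.all⁺ (λ next → noReturn k q next q next) (around q)
  (All.lookup (All.all⁺ (λ q → all (λ next → noReturn k q next q next) (around q)) folded
    (subst T (sym eq) tt)) (∈-folded q))) next∈)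

abstract
  -- The argument counts the steps after the first: two for closed walks of length three, five for
  -- those of length six.
  no-closed-3-walk : noClosedWalk 2 ≡ true
  no-closed-3-walk = refl

  no-closed-6-walk : noClosedWalk 5 ≡ true
  no-closed-6-walk = refl

parity : ∀ {k} → Fin k → Fin 2
parity zero    = 0F
parity (suc i) = cyc (parity i)

parity-inject₁ : ∀ {k} (i : Fin k) → parity (inject₁ i) ≡ parity i
parity-inject₁ zero    = refl
parity-inject₁ (suc i) = cong cyc (parity-inject₁ i)

module _ (m : ℕ) where

  open Tube m

  -- A cap takes the parity of the ring it is attached to: the first ring for `a` and `b`, the last
  -- for `c` and `t`.
  fold : V → Folded
  fold (a j)   = ‵a 0F j
  fold (b j)   = ‵b 0F j
  fold (c j)   = ‵c (parity (fromℕ m)) j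
  fold (t j)   = ‵t (parity (fromℕ m)) j
  fold (r i j) = ‵r (parity i) j
  fold (l i j) = ‵l (parity i) j
  fold (w g j) = ‵w (parity g) j
  fold (x i j) = ‵x (parity i) j
  fold (y i j) = ‵y (parity i) j

  -- The neighbour lists match except at `w`, where the entries `s` and `s + 4` are the inner and
  -- the cap alternative for the half-edge `s`; the remainder modulo four recovers `s`.
  slot : (v : V) → Fin (suc (deg-1 v)) → Fin (length (around (fold v)))
  slot (a j)   s = s
  slot (b j)   s = s
  slot (c j)   s = s
  slot (t j)   s = s
  slot (r i j) s = s
  slot (l i j) s = s
  slot (x i j) s = s
  slot (y i j) s = s
  slot (w g j) 0F with view g
  ... | ‵fromℕ     = 4F
  ... | ‵inject₁ i = 0F
  slot (w g j) 1F with view g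
  ... | ‵fromℕ     = 5F
  ... | ‵inject₁ i = 1F
  slot (w 0F      j) 2F = 6F
  slot (w (suc i) j) 2F = 2F
  slot (w 0F      j) 3F = 7F
  slot (w (suc i) j) 3F = 3F

  unslot : Fin 8 → Fin 4
  unslot s = proj₂ (remQuot {2} 4 s)

  unslot-slot : ∀ g j s → unslot (slot (w g j) s) ≡ s
  unslot-slot g j 0F with view g
  ... | ‵fromℕ     = refl
  ... | ‵inject₁ i = refl
  unslot-slot g j 1F with view g
  ... | ‵fromℕ     = refl
  ... | ‵inject₁ i = refl
  unslot-slot 0F      j 2F = refl
  unslot-slot (suc i) j 2F = refl
  unslot-slot 0F      j 3F = refl
  unslot-slot (suc i) j 3F = refl

  slot-injective : ∀ v {s s′} → slot v s ≡ slot v s′ → s ≡ s′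
  slot-injective (a j)   eq = eq
  slot-injective (b j)   eq = eq
  slot-injective (c j)   eq = eq
  slot-injective (t j)   eq = eq
  slot-injective (r i j) eq = eq
  slot-injective (l i j) eq = eq
  slot-injective (x i j) eq = eq
  slot-injective (y i j) eq = eq
  slot-injective (w g j) {s} {s′} eq =
    trans (sym (unslot-slot g j s)) (trans (cong unslot eq) (unslot-slot g j s′))

  fold-target : ∀ v s → fold (proj₁ (flip (v , s))) ≡ lookup (around (fold v)) (slot v s)
  fold-target (a j) 0F = refl
  fold-target (a j) 1F = refl
  fold-target (a j) 2F = refl
  fold-target (b j) 0F = refl
  fold-target (b j) 1F = refl
  fold-target (b j) 2F = refl
  fold-target (c j) 0F = refl
  fold-target (c j) 1F = refl
  fold-target (c j) 2F = refl
  fold-target (t j) 0F = refl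
  fold-target (t j) 1F = refl
  fold-target (t j) 2F = refl
  fold-target (r i j) 0F = refl
  fold-target (r i j) 1F = refl
  fold-target (r i j) 2F = refl
  fold-target (l i j) 0F = refl
  fold-target (l i j) 1F = refl
  fold-target (l i j) 2F = refl
  fold-target (w g j) 0F with view g
  ... | ‵fromℕ     = refl
  ... | ‵inject₁ i = cong (λ p → ‵x p (cyc j)) (sym (parity-inject₁ i))
  fold-target (w g j) 1F with view g
  ... | ‵fromℕ     = refl
  ... | ‵inject₁ i = cong (λ p → ‵x p j) (sym (parity-inject₁ i))
  fold-target (w 0F      j) 2F = refl
  fold-target (w (suc i) j) 2F = cong (λ p → ‵y p j) (sym (cyc⁻¹-cyc (parity i)))
  fold-target (w 0F      j) 3F = refl
  fold-target (w (suc i) j) 3F = cong (λ p → ‵y p (cyc j)) (sym (cyc⁻¹-cyc (parity i)))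
  fold-target (x i j) 0F = refl
  fold-target (x i j) 1F = refl
  fold-target (x i j) 2F = cong (λ p → ‵w p (cyc⁻¹ j)) (parity-inject₁ i)
  fold-target (x i j) 3F = cong (λ p → ‵w p j) (parity-inject₁ i)
  fold-target (y i j) 0F = refl
  fold-target (y i j) 1F = refl
  fold-target (y i j) 2F = refl
  fold-target (y i j) 3F = refl

  fold-neighbour : ∀ v s → fold (proj₁ (flip (v , s))) ∈ around (fold v)
  fold-neighbour v s = subst (_∈ around (fold v)) (sym (fold-target v s)) (∈-lookup (slot v s))

  -- Different half-edges at `v` occupy different places in a list without repetitions, so folding
  -- is injective on the neighbours of `v`.
  fold-injective : ∀ v {s s′} → fold (proj₁ (flip (v , s))) ≡ fold (proj₁ (flip (v , s′))) → s ≡ s′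
  fold-injective v {s} {s′} eq = slot-injective v (lookup-injective (AllPairs.tail (around-unique (fold v)))
    (trans (sym (fold-target v s)) (trans eq (fold-target v s′))))

  tube : Ribbon
  tube = record
    { Vertex    = V
    ; deg-1     = deg-1
    ; flip      = flip
    ; flip-flip = flip-flip
    ; loopless  = λ (v , s) eq → All.lookup (AllPairs.head (around-unique (fold v)))
                    (fold-neighbour v s) (cong fold (sym eq))
    ; simple    = λ v eq → fold-injective v (cong fold eq)
    }

  open Ribbon tube using (Linked; linked-sym; target; NoTriangle; NoHexagon)

  fold-linked : ∀ {u v} → Linked u v → fold v ∈ around (fold u)
  fold-linked {u} (s , refl) = fold-neighbour u s

  fold-locally-injective : ∀ {u v v′} → Linked u v → Linked u v′ → fold v ≡ fold v′ → v ≡ v′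
  fold-locally-injective {u} (s , refl) (s′ , refl) eq =
    cong (λ s → target (u , s)) (fold-injective u eq)

  Safe : ℕ → V → V → V → V → Set
  Safe k start next u v = NoReturn k (fold start) (fold next) (fold u) (fold v)

  -- Both `u` and `v′` are neighbours of `v`, so by local injectivity the folded walk turns back at
  -- `v` only if the walk in the tube does.
  extend : ∀ {k start next u v v′} → Linked u v → Linked v v′ → v′ ≢ u →
           Safe (suc k) start next u v → Safe k start next v v′
  extend uv vv′ v′≢u safe = noReturn-step safe (fold-linked vv′)
    (v′≢u ∘ fold-locally-injective vv′ (linked-sym uv))

  -- The check gives equality of the folded vertices, which lifts because both vertices are
  -- neighbours of `start`.
  closes-from : ∀ {start next u} → Linked u start → Linked start next → Safe 0 start next u start → u ≡ next
  closes-from us sn safe = fold-locally-injective (linked-sym us) sn (noReturn-end safe)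

  no-triangle : NoTriangle
  no-triangle e₀₁ e₁₂ e₂₀ v₂≢v₀ v₀≢v₁ = closes-from e₂₀ e₀₁
    (extend e₁₂ e₂₀ v₀≢v₁
    (extend e₀₁ e₁₂ v₂≢v₀
    (noReturn-start 2 no-closed-3-walk (fold-linked e₀₁))))

  no-hexagon : NoHexagon
  no-hexagon e₀₁ e₁₂ e₂₃ e₃₄ e₄₅ e₅₀ v₂≢v₀ v₃≢v₁ v₄≢v₂ v₅≢v₃ v₀≢v₄ = closes-from e₅₀ e₀₁
    (extend e₄₅ e₅₀ v₀≢v₄
    (extend e₃₄ e₄₅ v₅≢v₃
    (extend e₂₃ e₃₄ v₄≢v₂
    (extend e₁₂ e₂₃ v₃≢v₁
    (extend e₀₁ e₁₂ v₂≢v₀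
    (noReturn-start 5 no-closed-6-walk (fold-linked e₀₁)))))))

  -- Connectedness of the tube

  infix 4 _~_
  _~_ : V → V → Set
  _~_ = EqClosure Linked

  infixr 5 _▸_
  _▸_ : ∀ {u v v′} → u ~ v → v ~ v′ → u ~ v′
  _▸_ = Eq.transitive Linked

  along : ∀ d → proj₁ d ~ target d
  along (v , s) = Eq.return (s , refl)

  back : ∀ d → target d ~ proj₁ d
  back d = Eq.symmetric Linked (along d)

  reach-b : ∀ j → b 0F ~ b j
  reach-b 0F = Eq.reflexive Linked
  reach-b 1F = along (b 0F , 0F)
  reach-b 2F = along (b 0F , 0F) ▸ along (b 1F , 0F)
  reach-b 3F = back (b 3F , 0F)

  reach-a : ∀ j → b 0F ~ a j
  reach-a j = reach-b j ▸ along (b j , 1F)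

  -- Each period is climbed from ring to ring through `x`, `r` and `y` of the same column.
  reach-w : ∀ j g → b 0F ~ w g j
  reach-w j = <-weakInduction _ (reach-a j ▸ along (a j , 0F)) λ i reached →
    reached ▸ back (x i j , 3F) ▸ along (x i j , 0F) ▸ along (r i j , 1F) ▸ along (y i j , 0F)

  reach-x : ∀ i j → b 0F ~ x i j
  reach-x i j = reach-w j (inject₁ i) ▸ back (x i j , 3F)

  reach-c : ∀ j → b 0F ~ c j
  reach-c j = reach-w j (fromℕ m) ▸ back (c j , 2F)

  reach : ∀ v → b 0F ~ v
  reach (a j)   = reach-a j
  reach (b j)   = reach-b j
  reach (c j)   = reach-c j
  reach (t j)   = reach-c j ▸ along (c j , 0F)
  reach (r i j) = reach-x i j ▸ along (x i j , 0F)
  reach (l i j) = reach-x i j ▸ along (x i j , 1F)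
  reach (w g j) = reach-w j g
  reach (x i j) = reach-x i j
  reach (y i j) = reach-x i j ▸ along (x i j , 0F) ▸ along (r i j , 1F)

  2≤deg-1 : ∀ v → 2 ℕ.≤ deg-1 v
  2≤deg-1 (_ , inj₁ _) = ℕ.≤-refl
  2≤deg-1 (_ , inj₂ _) = ℕ.n≤1+n 2

extremal-graphs : ∀ (N : ℕ) → ∃[ n ] n ℕ.≥ N × (Σ[ G ∈ Graph n ]
  (C 6 isFree) G × (C 3 isFree) G × Planar G × δ G ℕ.≥ 3 ×
  + edgeCount G ≡ floor (+ 9 / 5 * (+ n / 1) - + 4 / 1))
extremal-graphs N =
  -- A tube with `N` periods has `20 + 20 N` vertices.
  n , subst (N ℕ.≤_) (sym linear) (ℕ.m≤m+n N (20 ℕ.+ 19 ℕ.* N)) , graph ,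
  C₆-free (no-hexagon N) , C₃-free (no-triangle N) ,
  planar (2≤deg-1 N) {e} halves↔ face-cycles F↔ (b 0F) (reach N) euler ,
  δ≥3 (2≤deg-1 N) (s≤s (s≤s (s≤s z≤n))) ,
  extremal (2≤deg-1 N) {e} halves↔ tight
  where
  open Tube N
  open Count
  open RibbonGraph (tube N) V↔
  halves↔ : H ↔ Fin (e ℕ.* 2)
  halves↔ = subst (λ k → H ↔ Fin k) halves H↔

theorem1p5 : (∀ (n : ℕ) (G : Graph n) →
    (C 6 isFree) G → (C 3 isFree) G → Planar G → δ G ℕ.≥ 3 →
    + edgeCount G ≤ floor (+ 9 / 5 * (+ n / 1) - + 4 / 1))
    ×
    (∀ (N : ℕ) → ∃[ n ] n ℕ.≥ N × (Σ[ G ∈ Graph n ]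
    (C 6 isFree) G × (C 3 isFree) G × Planar G × δ G ℕ.≥ 3 ×
    + edgeCount G ≡ floor (+ 9 / 5 * (+ n / 1) - + 4 / 1)))
theorem1p5 = upper-bound , extremal-graphs
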